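{- Let $n,m\ge 3$ and let $\mathcal{S}=(s_{1},\ldots,s_{n})$ and $\mathcal{T}=(t_{1},\ldots,t_{m})$ be the $3d$-quiddity sequences of two $3d$-dissections of an $n$-gon and an $m$-gon respectively, which are either both even or both odd. Then each of the $2n$ sequences $\mathcal{S}\circ_{k}\mathcal{T}$ and $\mathcal{S}\bullet_{k}\mathcal{T}$, $k=1,2,\ldots,n$, is a solution in positive integers of the equation $M_{n+m-1}(a_{1},\ldots,a_{n+m-1})=-Id$.
   Context: For a sequence $(a_1,\ldots,a_N)$, $$M_{N}(a_{1},\ldots,a_{N})=\begin{pmatrix} a_{N} & -1\\ 1 & 0\end{pmatrix}\begin{pmatrix} a_{N-1} & -1\\ 1 & 0\end{pmatrix}\cdots\begin{pmatrix} a_{1} & -1\\ 1 & 0\end{pmatrix},$$ and $Id$ is the $2\times 2$ identity matrix. A $3d$-dissection is a partition of a convex $n$-gon (vertices labeled counterclockwise $1,\ldots,n$) into sub-polygons by means of pairwise non-crossing diagonals such that the number of vertices of every sub-polygon is a multiple of $3$. Its $3d$-quiddity sequence is $(a_1,\ldots,a_n)$ where $a_i$ is the number of sub-polygons adjacent to vertex $i$. A $3d$-dissection is even if the total number of its sub-polygons with an even number of vertices ($6$-gons, $12$-gons, ...) is even; otherwise it is odd. Products: for $1\le k\le n-1$, $$\mathcal{S}\circ_{k}\mathcal{T}=(s_{1},\ldots,s_{k-1}, s_{k}+t_{1}+1,t_{2},\ldots,t_{m-1}, t_{m}+1, s_{k+1}+1,s_{k+2},\ldots,s_{n}),$$ $$\mathcal{S}\circ_{n}\mathcal{T}=(s_{1}+1,s_{2},\ldots,s_{n-1},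 s_{n}+t_{1}+1,t_{2},\ldots,t_{m-1}, t_{m}+1);$$ for $2\le k\le n$, $$\mathcal{S}\bullet_{k}\mathcal{T}=(s_{1},\ldots,s_{k-2},s_{k-1}+1,t_{2}+1,t_{3},\ldots,t_{m},s_{k}+t_{1}+1,s_{k+1},\ldots,s_{n}),$$ $$\mathcal{S}\bullet_{1}\mathcal{T}=(s_{1}+t_{1}+1,s_{2},\ldots,s_{n-1},s_{n}+1,t_{2}+1,t_{3},\ldots,t_{m}).$$ -}

module Defs where

open import Level using (0ℓ)
open import Data.Bool.Base using (if_then_else_)
open import Data.Fin.Base as Fin using (Fin)
import Data.Fin.Properties as Fin
open import Data.Fin.Subset using (Subset; inside; outside; _∈_; ⊤; ∣_∣)
open import Data.Fin.Subset.Properties using (_∈?_)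
open import Data.Integer.Base as ℤ using (ℤ; 0ℤ; 1ℤ; -1ℤ)
open import Data.List.Base using (List; []; _∷_; [_]; _++_; map; filter; length; take; drop; tabulate)
open import Data.List.Relation.Unary.All using (All)
open import Data.Nat.Base using (ℕ; zero; suc; _+_; _∸_; _≤_; _<_; _<ᵇ_; _≡ᵇ_)
open import Data.Nat.Divisibility using (_∣_; _∣?_)
import Data.Nat.Properties as ℕ
open import Data.Product.Base using (_×_)
open import Data.Sum.Base using (_⊎_)
open import Data.Vec.Base using ([]; _∷_)
open import Relation.Binary.Core using (Rel)
open import Relation.Binary.Definitions using (Decidable)
open import Relation.Binary.PropositionalEquality using (_≡_)
open import Relation.Nullary.Decidable using (Dec; ¬?; _×-dec_; _⊎-dec_; _→-dec_)
open import Relation.Nullary.Negation using (¬_)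

------------------------------------------------------------------------
-- The matrices M_N

record Mat₂ : Set where
  constructor mat
  field
    m₁₁ m₁₂ m₂₁ m₂₂ : ℤ

infixl 7 _⊗_

_⊗_ : Mat₂ → Mat₂ → Mat₂
mat a b c d ⊗ mat a′ b′ c′ d′ =
  mat (a ℤ.* a′ ℤ.+ b ℤ.* c′) (a ℤ.* b′ ℤ.+ b ℤ.* d′)
      (c ℤ.* a′ ℤ.+ d ℤ.* c′) (c ℤ.* b′ ℤ.+ d ℤ.* d′)

Id : Mat₂
Id = mat 1ℤ 0ℤ
         0ℤ 1ℤ

infix 8 ⊖_

⊖_ : Mat₂ → Mat₂
⊖ mat a b c d = mat (ℤ.- a) (ℤ.- b) (ℤ.- c) (ℤ.- d)

-- The first term of the sequence gives the rightmost factor.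
M : List ℤ → Mat₂
M []       = Id
M (a ∷ as) = M as ⊗ mat a  -1ℤ
                        1ℤ 0ℤ

IsPositiveSolution : ℕ → List ℕ → Set
IsPositiveSolution N as = length as ≡ N × All (0 <_) as × M (map ℤ.+_ as) ≡ ⊖ Id

------------------------------------------------------------------------
-- Polygons and dissections
--
-- The vertices 1, …, n of the convex n-gon are the elements of Fin n in
-- counterclockwise order.  A set V of vertices stands for the convex
-- polygon that it spans, and an unordered pair of vertices for the pair
-- (i , j) with i < j.

-- {i , j} is a side of V when all other vertices of V lie on the same
-- side of the chord.  In particular the sides of the n-gon are those of ⊤.
Side : ∀ {n} → Subset n → Fin n → Fin n → Set
Side V i j = i ∈ V × j ∈ V × i Fin.< j ×
  ((∀ k → k ∈ V → ¬ (i Fin.< k × k Fin.< j)) ⊎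
   (∀ k → k ∈ V → i Fin.≤ k × k Fin.≤ j))

Diagonal : ∀ {n} → Subset n → Fin n → Fin n → Set
Diagonal V i j = i ∈ V × j ∈ V × i Fin.< j × ¬ Side V i j

side? : ∀ {n} (V : Subset n) → Decidable (Side V)
side? V i j = i ∈? V ×-dec j ∈? V ×-dec i Fin.<? j ×-dec
  (Fin.all? (λ k → k ∈? V →-dec ¬? (i Fin.<? k ×-dec k Fin.<? j)) ⊎-dec
   Fin.all? (λ k → k ∈? V →-dec (i Fin.≤? k ×-dec k Fin.≤? j)))

diagonal? : ∀ {n} (V : Subset n) → Decidable (Diagonal V)
diagonal? V i j = i ∈? V ×-dec j ∈? V ×-dec i Fin.<? j ×-dec ¬? (side? V i j)

subsets : ∀ n → List (Subset n)
subsets zero    = [ [] ]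
subsets (suc n) = map (inside ∷_) (subsets n) ++ map (outside ∷_) (subsets n)

record Dissection (n : ℕ) : Set₁ where
  field
    Cut         : Rel (Fin n) 0ℓ
    cut?        : Decidable Cut
    diagonal    : ∀ {i j} → Cut i j → Diagonal ⊤ i j
    nonCrossing : ∀ {i j k l} → Cut i j → Cut k l →
                  ¬ (i Fin.< k × k Fin.< j × j Fin.< l)

  -- The polygons bounded by sides of the n-gon and cuts, and not divided
  -- any further by a cut.
  SubPolygon : Subset n → Set
  SubPolygon V = 3 ≤ ∣ V ∣
               × (∀ i j → Side V i j → Side ⊤ i j ⊎ Cut i j)
               × (∀ i j → Diagonal V i j → ¬ Cut i j)

  subPolygon? : (V : Subset n) → Dec (SubPolygon V)
  subPolygon? V = 3 ℕ.≤? ∣ V ∣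
    ×-dec Fin.all? (λ i → Fin.all? λ j → side? V i j →-dec (side? ⊤ i j ⊎-dec cut? i j))
    ×-dec Fin.all? (λ i → Fin.all? λ j → diagonal? V i j →-dec ¬? (cut? i j))

  subPolygons : List (Subset n)
  subPolygons = filter subPolygon? (subsets n)

  Is3d : Set
  Is3d = All (λ V → 3 ∣ ∣ V ∣) subPolygons

  quiddity : List ℕ
  quiddity = tabulate λ i → length (filter (i ∈?_) subPolygons)

  Even : Set
  Even = 2 ∣ length (filter (λ V → 2 ∣? ∣ V ∣) subPolygons)

  Odd : Set
  Odd = ¬ Even

------------------------------------------------------------------------
-- The products

-- Terms are numbered from 1.  The value 0 outside the range 1, …, length s
-- is a dummy.
infixl 8 _‼_

_‼_ : List ℕ → ℕ → ℕ
[]      ‼ _           = 0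
(_ ∷ _) ‼ zero        = 0
(a ∷ _) ‼ suc zero    = a
(_ ∷ s) ‼ suc (suc i) = s ‼ suc i

-- s ⟨ i ⋯ j ⟩ is (sᵢ , … , sⱼ) for i ≥ 1, and empty if j < i.
infixl 8 _⟨_⋯_⟩

_⟨_⋯_⟩ : List ℕ → ℕ → ℕ → List ℕ
s ⟨ i ⋯ j ⟩ = take (suc j ∸ i) (drop (i ∸ 1) s)

infix 6 _∘[_]_ _•[_]_

-- Meaningful for 1 ≤ k ≤ length s.
_∘[_]_ : List ℕ → ℕ → List ℕ → List ℕ
s ∘[ k ] t =
  if k <ᵇ n
  then s ⟨ 1 ⋯ k ∸ 1 ⟩ ++ [ s ‼ k + t ‼ 1 + 1 ] ++ t ⟨ 2 ⋯ m ∸ 1 ⟩ ++ [ t ‼ m + 1 ]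
         ++ [ s ‼ (k + 1) + 1 ] ++ s ⟨ k + 2 ⋯ n ⟩
  else [ s ‼ 1 + 1 ] ++ s ⟨ 2 ⋯ n ∸ 1 ⟩ ++ [ s ‼ n + t ‼ 1 + 1 ] ++ t ⟨ 2 ⋯ m ∸ 1 ⟩
         ++ [ t ‼ m + 1 ]
  where
  n = length s
  m = length t

-- Meaningful for 1 ≤ k ≤ length s.
_•[_]_ : List ℕ → ℕ → List ℕ → List ℕ
s •[ k ] t =
  if k ≡ᵇ 1
  then [ s ‼ 1 + t ‼ 1 + 1 ] ++ s ⟨ 2 ⋯ n ∸ 1 ⟩ ++ [ s ‼ n + 1 ] ++ [ t ‼ 2 + 1 ]
         ++ t ⟨ 3 ⋯ m ⟩
  else s ⟨ 1 ⋯ k ∸ 2 ⟩ ++ [ s ‼ (k ∸ 1) + 1 ] ++ [ t ‼ 2 + 1 ] ++ t ⟨ 3 ⋯ m ⟩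
         ++ [ s ‼ k + t ‼ 1 + 1 ] ++ s ⟨ k + 1 ⋯ n ⟩
  where
  n = length s
  m = length t

{-# OPTIONS --safe #-}

-- Write A(a) for the factor of M belonging to a.  As A(x + y) = A(x) A(0)⁻¹ A(y)
-- and A(0)² = -Id, gluing two polygons along a side multiplies their matrices,
-- up to the sign -1, as soon as these are ± Id.
--
-- Call the sides of the n-gon and the cuts edges.  For an edge (i , j) with
-- i < j count only the sub-polygons lying between i and j.  The resulting
-- sequence on [i , j] has matrix -(-1)ᵉ Id, where e is the number of even
-- sub-polygons among them.  This follows by induction on j - i: the sub-polygon
-- V at the edge (i , j) consists of the vertices not separated from (i , j) by
-- another edge, its remaining sides bound shorter intervals, and V itself
-- contributes A(1)^∣V∣, where A(1)³ = -Id and 3 ∣ ∣V∣.  For the edge (1 , n) this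
-- computes the matrix of the quiddity sequence.
--
-- Up to rotation, both products glue a triangle between the two polygons.
module Submission where

open import Defs
open import Algebra.Bundles using (Monoid)
open import Data.Bool.Base using (true; false; if_then_else_; T)
import Data.Bool.Properties as Bool
open import Data.Fin.Base as Fin using (Fin; zero; suc; toℕ; fromℕ<; fromℕ)
import Data.Fin.Properties as Fin
open import Data.Fin.Subset using (Subset; inside; outside; _∈_; _∉_; _∪_; _-_; ⁅_⁆; ⊤; ∣_∣)
open import Data.Fin.Subset.Properties as Subset using (_∈?_)
open import Data.Integer.Base as ℤ using (ℤ; 0ℤ; 1ℤ; -1ℤ)
import Data.Integer.Properties as ℤ
open import Data.Integer.Tactic.RingSolver using (solve-∀)
open import Data.List.Base using (List; []; _∷_; _++_; map; [_]; length; take; initLast; _∷ʳ′_; filter; tabulate)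
import Data.List.Membership.Propositional as ListMem
import Data.List.Membership.Propositional.Properties as ListMem
import Data.List.Properties as List
open import Data.List.Relation.Unary.All as All using (All; []; _∷_)
import Data.List.Relation.Unary.All.Properties as All
open import Data.List.Relation.Unary.Any using (here)
open import Data.Nat.Base as ℕ using (ℕ; zero; suc; _+_; _≤_; _<_; _∸_; s≤s; z≤n; _*_)
open import Data.Nat.Divisibility using (_∣_; _∣?_; divides-refl; ∣m+n∣m⇒∣n; n∣m*n; ∣m⇒∣m*n)
import Data.Nat.Properties as ℕ
open import Data.Nat.Tactic.RingSolver using () renaming (solve-∀ to solveℕ-∀)
open import Data.Product.Base using (_,_; _×_; ∃; ∃₂; proj₁; proj₂)
open import Data.Sum.Base as Sum using (_⊎_; inj₁; inj₂)
open import Data.Vec.Base as Vec using ([]; _∷_; here; there)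
import Data.Vec.Properties as Vec
open import Function.Base using (_∘_)
open import Level using (0ℓ)
open import Relation.Binary.Definitions using (tri<; tri≈; tri>)
open import Relation.Binary.PropositionalEquality using (_≡_; _≢_; refl; sym; trans; cong; cong₂; subst; isEquivalence; module ≡-Reasoning; subst₂)
open import Relation.Nullary.Decidable using (Dec; yes; no; does; _×-dec_; ¬?; dec-true; decidable-stable; _⊎-dec_; _→-dec_)
open import Relation.Nullary.Negation using (¬_; contradiction)
open import Relation.Unary using (Decidable)
open import Tactic.MonoidSolver using (solve)
open Dissection using (Is3d; Even; Odd; quiddity)

-- Continued products of matrices

mat-cong : ∀ {a b c d a′ b′ c′ d′} → a ≡ a′ → b ≡ b′ → c ≡ c′ → d ≡ d′ →
           mat a b c d ≡ mat a′ b′ c′ d′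
mat-cong refl refl refl refl = refl

⊗-assoc : ∀ X Y Z → (X ⊗ Y) ⊗ Z ≡ X ⊗ (Y ⊗ Z)
⊗-assoc (mat a b c d) (mat e f g h) (mat i j k l) =
  mat-cong (entry a b e f g h i k) (entry a b e f g h j l)
           (entry c d e f g h i k) (entry c d e f g h j l)
  where
  entry : ∀ a b e f g h i k →
    (a ℤ.* e ℤ.+ b ℤ.* g) ℤ.* i ℤ.+ (a ℤ.* f ℤ.+ b ℤ.* h) ℤ.* k ≡
    a ℤ.* (e ℤ.* i ℤ.+ f ℤ.* k) ℤ.+ b ℤ.* (g ℤ.* i ℤ.+ h ℤ.* k)
  entry = solve-∀

⊗-identityˡ : ∀ X → Id ⊗ X ≡ X
⊗-identityˡ (mat a b c d) = mat-cong (l a c) (l b d) (r a c) (r b d)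
  where
  l : ∀ x y → 1ℤ ℤ.* x ℤ.+ 0ℤ ℤ.* y ≡ x
  l = solve-∀
  r : ∀ x y → 0ℤ ℤ.* x ℤ.+ 1ℤ ℤ.* y ≡ y
  r = solve-∀

⊗-identityʳ : ∀ X → X ⊗ Id ≡ X
⊗-identityʳ (mat a b c d) = mat-cong (l a b) (r a b) (l c d) (r c d)
  where
  l : ∀ x y → x ℤ.* 1ℤ ℤ.+ y ℤ.* 0ℤ ≡ x
  l = solve-∀
  r : ∀ x y → x ℤ.* 0ℤ ℤ.+ y ℤ.* 1ℤ ≡ y
  r = solve-∀

⊗-monoid : Monoid 0ℓ 0ℓ
⊗-monoid = record
  { Carrier = Mat₂ ; _≈_ = _≡_ ; _∙_ = _⊗_ ; ε = Id
  ; isMonoid = record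
    { isSemigroup = record
      { isMagma = record { isEquivalence = isEquivalence ; ∙-cong = cong₂ _⊗_ }
      ; assoc = ⊗-assoc }
    ; identity = ⊗-identityˡ , ⊗-identityʳ } }

-- Stated for an abstract monoid, since the solver would unfold the entries of ⊗.
module Reassociate (𝓜 : Monoid 0ℓ 0ℓ) where
  open Monoid 𝓜

  reassoc₄ : ∀ w x y z → (w ∙ x) ∙ (y ∙ z) ≈ (w ∙ (x ∙ y)) ∙ z
  reassoc₄ w x y z = solve 𝓜

  reassoc-square : ∀ x j y → ((x ∙ j) ∙ ε) ∙ (j ∙ y) ≈ (x ∙ (j ∙ j)) ∙ y
  reassoc-square x j y = solve 𝓜

  reassoc-glue : ∀ y b j u d z c v →
    (((y ∙ ((b ∙ j) ∙ u)) ∙ ((u ∙ j) ∙ d)) ∙ z) ∙ ((c ∙ j) ∙ ((u ∙ j) ∙ v)) ≈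
    ((y ∙ b) ∙ (((((j ∙ u) ∙ u) ∙ j) ∙ ((d ∙ z) ∙ c)) ∙ (j ∙ (u ∙ j)))) ∙ v
  reassoc-glue y b j u d z c v = solve 𝓜

  reassoc-step : ∀ u j x y z → ((u ∙ j) ∙ x) ∙ ((y ∙ j) ∙ z) ≈ ((u ∙ j) ∙ (x ∙ y)) ∙ (j ∙ z)
  reassoc-step u j x y z = solve 𝓜

open Reassociate ⊗-monoid

⊖-involutive : ∀ X → ⊖ ⊖ X ≡ X
⊖-involutive (mat a b c d) =
  mat-cong (ℤ.neg-involutive a) (ℤ.neg-involutive b) (ℤ.neg-involutive c) (ℤ.neg-involutive d)

⊖-⊗ : ∀ X Y → (⊖ X) ⊗ Y ≡ ⊖ (X ⊗ Y)
⊖-⊗ (mat a b c d) (mat e f g h) = mat-cong (l a b e g) (l a b f h) (l c d e g) (l c d f h)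
  where
  l : ∀ a b e g → (ℤ.- a) ℤ.* e ℤ.+ (ℤ.- b) ℤ.* g ≡ ℤ.- (a ℤ.* e ℤ.+ b ℤ.* g)
  l = solve-∀

⊗-⊖ : ∀ X Y → X ⊗ (⊖ Y) ≡ ⊖ (X ⊗ Y)
⊗-⊖ (mat a b c d) (mat e f g h) = mat-cong (l a b e g) (l a b f h) (l c d e g) (l c d f h)
  where
  l : ∀ a b e g → a ℤ.* (ℤ.- e) ℤ.+ b ℤ.* (ℤ.- g) ≡ ℤ.- (a ℤ.* e ℤ.+ b ℤ.* g)
  l = solve-∀

-- The sign (-1)^e acting on `X`. Keeping the exponent as a natural number lets it be a count of
-- even sub-polygons.
⊖^ : ℕ → Mat₂ → Mat₂
⊖^ zero    X = X
⊖^ (suc e) X = ⊖ (⊖^ e X)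

⊖^-⊗ : ∀ e X Y → ⊖^ e X ⊗ Y ≡ ⊖^ e (X ⊗ Y)
⊖^-⊗ zero    X Y = refl
⊖^-⊗ (suc e) X Y = trans (⊖-⊗ (⊖^ e X) Y) (cong ⊖_ (⊖^-⊗ e X Y))

⊗-⊖^ : ∀ e X Y → X ⊗ ⊖^ e Y ≡ ⊖^ e (X ⊗ Y)
⊗-⊖^ zero    X Y = refl
⊗-⊖^ (suc e) X Y = trans (⊗-⊖ X (⊖^ e Y)) (cong ⊖_ (⊗-⊖^ e X Y))

⊖^-+ : ∀ d e X → ⊖^ (d + e) X ≡ ⊖^ d (⊖^ e X)
⊖^-+ zero    e X = refl
⊖^-+ (suc d) e X = cong ⊖_ (⊖^-+ d e X)

⊖^-⊖ : ∀ e X → ⊖^ e (⊖ X) ≡ ⊖ (⊖^ e X)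
⊖^-⊖ zero    X = refl
⊖^-⊖ (suc e) X = cong ⊖_ (⊖^-⊖ e X)

⊖^-involutive : ∀ e X → ⊖^ e (⊖^ e X) ≡ X
⊖^-involutive zero    X = refl
⊖^-involutive (suc e) X = begin
  ⊖ ⊖^ e (⊖ ⊖^ e X)   ≡⟨ cong ⊖_ (⊖^-⊖ e _) ⟩
  ⊖ ⊖ ⊖^ e (⊖^ e X)   ≡⟨ ⊖-involutive _ ⟩
  ⊖^ e (⊖^ e X)       ≡⟨ ⊖^-involutive e X ⟩
  X                   ∎
  where open ≡-Reasoning

A : ℤ → Mat₂
A x = mat x -1ℤ 1ℤ 0ℤ

-- The inverse of A 0ℤ.
J : Mat₂
J = mat 0ℤ 1ℤ -1ℤ 0ℤ

-- `A x ⊗ J` is the unipotent matrix with upper right entry `x`, and multiplying by it on the left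
-- shifts the entry `y` of `A y` by `x`.
A-+ : ∀ x y → A (x ℤ.+ y) ≡ (A x ⊗ J) ⊗ A y
A-+ x y = mat-cong (p x y) (q x) (r y) refl
  where
  p : ∀ x y → x ℤ.+ y ≡ (x ℤ.* 0ℤ ℤ.+ -1ℤ ℤ.* -1ℤ) ℤ.* y ℤ.+ (x ℤ.* 1ℤ ℤ.+ -1ℤ ℤ.* 0ℤ) ℤ.* 1ℤ
  p = solve-∀
  q : ∀ x → -1ℤ ≡ (x ℤ.* 0ℤ ℤ.+ -1ℤ ℤ.* -1ℤ) ℤ.* -1ℤ ℤ.+ (x ℤ.* 1ℤ ℤ.+ -1ℤ ℤ.* 0ℤ) ℤ.* 0ℤ
  q = solve-∀
  r : ∀ y → 1ℤ ≡ (1ℤ ℤ.* 0ℤ ℤ.+ 0ℤ ℤ.* -1ℤ) ℤ.* y ℤ.+ (1ℤ ℤ.* 1ℤ ℤ.+ 0ℤ ℤ.* 0ℤ) ℤ.* 1ℤ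
  r = solve-∀

-- Read off from `A-+` with y = -x: the product A(x) J A(-x) is A(0), which a further `J` cancels.
A⁻¹ : ℤ → Mat₂
A⁻¹ x = (J ⊗ A (ℤ.- x)) ⊗ J

A-inverseʳ : ∀ x → A x ⊗ A⁻¹ x ≡ Id
A-inverseʳ x = begin
  A x ⊗ ((J ⊗ A (ℤ.- x)) ⊗ J) ≡⟨ ⊗-assoc (A x) (J ⊗ A (ℤ.- x)) J ⟨
  (A x ⊗ (J ⊗ A (ℤ.- x))) ⊗ J ≡⟨ cong (_⊗ J) (⊗-assoc (A x) J (A (ℤ.- x))) ⟨
  ((A x ⊗ J) ⊗ A (ℤ.- x)) ⊗ J ≡⟨ cong (_⊗ J) (A-+ x (ℤ.- x)) ⟨
  A (x ℤ.+ ℤ.- x) ⊗ J         ≡⟨ cong (λ y → A y ⊗ J) (ℤ.+-inverseʳ x) ⟩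
  Id                          ∎
  where open ≡-Reasoning

-- Since σ is central, Y A = σ gives A Y = A Y A A⁻¹ = σ.
A-rotate : ∀ e x Y → Y ⊗ A x ≡ ⊖^ e Id → A x ⊗ Y ≡ ⊖^ e Id
A-rotate e x Y YA = begin
  A x ⊗ Y                     ≡⟨ ⊗-identityʳ _ ⟨
  (A x ⊗ Y) ⊗ Id              ≡⟨ cong ((A x ⊗ Y) ⊗_) (A-inverseʳ x) ⟨
  (A x ⊗ Y) ⊗ (A x ⊗ A⁻¹ x)   ≡⟨ reassoc₄ (A x) Y (A x) (A⁻¹ x) ⟩
  (A x ⊗ (Y ⊗ A x)) ⊗ A⁻¹ x   ≡⟨ cong (λ Z → (A x ⊗ Z) ⊗ A⁻¹ x) YA ⟩
  (A x ⊗ ⊖^ e Id) ⊗ A⁻¹ x     ≡⟨ cong (_⊗ A⁻¹ x) (⊗-⊖^ e (A x) Id) ⟩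
  ⊖^ e (A x ⊗ Id) ⊗ A⁻¹ x     ≡⟨ ⊖^-⊗ e (A x ⊗ Id) (A⁻¹ x) ⟩
  ⊖^ e ((A x ⊗ Id) ⊗ A⁻¹ x)   ≡⟨ cong (λ Z → ⊖^ e (Z ⊗ A⁻¹ x)) (⊗-identityʳ (A x)) ⟩
  ⊖^ e (A x ⊗ A⁻¹ x)          ≡⟨ cong (⊖^ e) (A-inverseʳ x) ⟩
  ⊖^ e Id                     ∎
  where open ≡-Reasoning

-- J² = -Id.
J-⊖^-J : ∀ e X Y → ((X ⊗ J) ⊗ ⊖^ e Id) ⊗ (J ⊗ Y) ≡ ⊖ ⊖^ e (X ⊗ Y)
J-⊖^-J e X Y = begin
  ((X ⊗ J) ⊗ ⊖^ e Id) ⊗ (J ⊗ Y)   ≡⟨ cong (_⊗ (J ⊗ Y)) (⊗-⊖^ e (X ⊗ J) Id) ⟩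
  ⊖^ e ((X ⊗ J) ⊗ Id) ⊗ (J ⊗ Y)   ≡⟨ ⊖^-⊗ e _ _ ⟩
  ⊖^ e (((X ⊗ J) ⊗ Id) ⊗ (J ⊗ Y)) ≡⟨ cong (⊖^ e) (reassoc-square X J Y) ⟩
  ⊖^ e ((X ⊗ (J ⊗ J)) ⊗ Y)        ≡⟨ cong (λ Z → ⊖^ e (Z ⊗ Y)) (⊗-⊖ X Id) ⟩
  ⊖^ e (⊖ (X ⊗ Id) ⊗ Y)           ≡⟨ cong (⊖^ e) (⊖-⊗ (X ⊗ Id) Y) ⟩
  ⊖^ e (⊖ ((X ⊗ Id) ⊗ Y))         ≡⟨ ⊖^-⊖ e _ ⟩
  ⊖ ⊖^ e ((X ⊗ Id) ⊗ Y)           ≡⟨ cong (λ Z → ⊖ ⊖^ e (Z ⊗ Y)) (⊗-identityʳ X) ⟩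
  ⊖ ⊖^ e (X ⊗ Y)                  ∎
  where open ≡-Reasoning

M-++ : ∀ xs ys → M (xs ++ ys) ≡ M ys ⊗ M xs
M-++ []       ys = sym (⊗-identityʳ (M ys))
M-++ (x ∷ xs) ys = trans (cong (_⊗ A x) (M-++ xs ys)) (⊗-assoc (M ys) (M xs) (A x))

A₁^ : ℕ → Mat₂
A₁^ zero    = Id
A₁^ (suc c) = A₁^ c ⊗ A 1ℤ

-- Later factors are on the left, as in M.
∏ : (ℕ → Mat₂) → ℕ → ℕ → Mat₂
∏ F i zero    = Id
∏ F i (suc m) = ∏ F (suc i) m ⊗ F i

∏-+ : ∀ F i l m → ∏ F i (l + m) ≡ ∏ F (l + i) m ⊗ ∏ F i l
∏-+ F i zero    m = sym (⊗-identityʳ _)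
∏-+ F i (suc l) m = begin
  ∏ F (suc i) (l + m) ⊗ F i                   ≡⟨ cong (_⊗ F i) (∏-+ F (suc i) l m) ⟩
  (∏ F (l + suc i) m ⊗ ∏ F (suc i) l) ⊗ F i   ≡⟨ ⊗-assoc (∏ F (l + suc i) m) (∏ F (suc i) l) (F i) ⟩
  ∏ F (l + suc i) m ⊗ (∏ F (suc i) l ⊗ F i)   ≡⟨ cong (λ j → ∏ F j m ⊗ ∏ F i (suc l)) (ℕ.+-suc l i) ⟩
  ∏ F (suc l + i) m ⊗ ∏ F i (suc l)           ∎
  where open ≡-Reasoning

∏-suc : ∀ F i m → ∏ F i (suc m) ≡ F (m + i) ⊗ ∏ F i m
∏-suc F i zero    = trans (⊗-identityˡ (F i)) (sym (⊗-identityʳ (F i)))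
∏-suc F i (suc m) = begin
  ∏ F (suc i) (suc m) ⊗ F i               ≡⟨ cong (_⊗ F i) (∏-suc F (suc i) m) ⟩
  (F (m + suc i) ⊗ ∏ F (suc i) m) ⊗ F i   ≡⟨ ⊗-assoc (F (m + suc i)) (∏ F (suc i) m) (F i) ⟩
  F (m + suc i) ⊗ ∏ F i (suc m)           ≡⟨ cong (λ j → F j ⊗ ∏ F i (suc m)) (ℕ.+-suc m i) ⟩
  F (suc m + i) ⊗ ∏ F i (suc m)           ∎
  where open ≡-Reasoning

∏-cong : ∀ {F G} i m → (∀ k → i ≤ k → k < m + i → F k ≡ G k) → ∏ F i m ≡ ∏ G i m
∏-cong i zero    F≡G = refl
∏-cong i (suc m) F≡G = cong₂ _⊗_
  (∏-cong (suc i) m λ k i<k k<m+i → F≡G k (ℕ.<⇒≤ i<k) (subst (k <_) (ℕ.+-suc m i) k<m+i))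
  (F≡G i ℕ.≤-refl (ℕ.s≤s (ℕ.m≤n+m i m)))

∏-Id : ∀ {F} i m → (∀ k → i ≤ k → k < m + i → F k ≡ Id) → ∏ F i m ≡ Id
∏-Id {F} i m F≡Id = trans (∏-cong i m F≡Id) (constant i m)
  where
  constant : ∀ i m → ∏ (λ _ → Id) i m ≡ Id
  constant i zero    = refl
  constant i (suc m) = trans (⊗-identityʳ _) (constant (suc i) m)

-- Serves to replace a product over the interval of an edge by one over all vertices of the n-gon,
-- where the factors of a polygon are easy to multiply.
∏-support : ∀ {F} i m r → (∀ {k} → k < i → F k ≡ Id) → (∀ {k} → m + i ≤ k → F k ≡ Id) →
  ∏ F 0 ((m + i) + r) ≡ ∏ F i m
∏-support {F} i m r before after = begin
  ∏ F 0 ((m + i) + r)                       ≡⟨ ∏-+ F 0 (m + i) r ⟩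
  ∏ F (m + i + 0) r ⊗ ∏ F 0 (m + i)         ≡⟨ cong (_⊗ ∏ F 0 (m + i)) (∏-Id (m + i + 0) r λ k m+i≤k _ → after (ℕ.≤-trans (ℕ.m≤m+n (m + i) 0) m+i≤k)) ⟩
  Id ⊗ ∏ F 0 (m + i)                        ≡⟨ ⊗-identityˡ (∏ F 0 (m + i)) ⟩
  ∏ F 0 (m + i)                             ≡⟨ cong (∏ F 0) (ℕ.+-comm m i) ⟩
  ∏ F 0 (i + m)                             ≡⟨ ∏-+ F 0 i m ⟩
  ∏ F (i + 0) m ⊗ ∏ F 0 i                   ≡⟨ cong₂ (λ j X → ∏ F j m ⊗ X) (ℕ.+-identityʳ i) (∏-Id 0 i λ k _ k<i → before (subst (k <_) (ℕ.+-identityʳ i) k<i)) ⟩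
  ∏ F i m ⊗ Id                              ≡⟨ ⊗-identityʳ (∏ F i m) ⟩
  ∏ F i m                                   ∎
  where open ≡-Reasoning

-- The products of sequences

-- The exponent `e` is 1 for even dissections (matrix -Id) and 2 for odd ones (matrix Id), and
-- `Solution 1` unfolds to `IsPositiveSolution`.
Solution : ℕ → ℕ → List ℕ → Set
Solution e N as = length as ≡ N × All (0 <_) as × M (map ℤ.+_ as) ≡ ⊖^ e Id

rotate₁ : ∀ {e N} a as → Solution e N (a ∷ as) → Solution e N (as ++ [ a ])
rotate₁ {e} a as (len , a>0 ∷ as>0 , prod) =
  trans (List.length-++-comm as [ a ]) len ,
  All.++⁺ as>0 (a>0 ∷ []) ,
  (begin
    M (map ℤ.+_ (as ++ [ a ]))               ≡⟨ cong M (List.map-++ ℤ.+_ as [ a ]) ⟩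
    M (map ℤ.+_ as ++ [ ℤ.+ a ])             ≡⟨ M-++ (map ℤ.+_ as) [ ℤ.+ a ] ⟩
    (Id ⊗ A (ℤ.+ a)) ⊗ M (map ℤ.+_ as)       ≡⟨ cong (_⊗ M (map ℤ.+_ as)) (⊗-identityˡ (A (ℤ.+ a))) ⟩
    A (ℤ.+ a) ⊗ M (map ℤ.+_ as)              ≡⟨ A-rotate e (ℤ.+ a) _ prod ⟩
    ⊖^ e Id                                  ∎)
  where open ≡-Reasoning

-- Allows any side of a polygon to be moved to the ends of its sequence, so that gluing needs to be
-- treated in one position only.
rotate : ∀ {e N} as bs → Solution e N (as ++ bs) → Solution e N (bs ++ as)
rotate {e} {N} []       bs sol = subst (Solution e N) (sym (List.++-identityʳ bs)) sol
rotate {e} {N} (a ∷ as) bs sol =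
  subst (Solution e N) (List.++-assoc bs [ a ] as)
    (rotate as (bs ++ [ a ])
      (subst (Solution e N) (List.++-assoc as bs [ a ]) (rotate₁ a (as ++ bs) sol)))

-- A triangle glued between two polygons: its three vertices contribute the
-- factors A 1ℤ.
glue-matrix : ∀ e a b c d Y Z →
  (Y ⊗ A b) ⊗ A a ≡ ⊖^ e Id → (A d ⊗ Z) ⊗ A c ≡ ⊖^ e Id →
  (((Y ⊗ A (b ℤ.+ 1ℤ)) ⊗ A (1ℤ ℤ.+ d)) ⊗ Z) ⊗ A (c ℤ.+ (1ℤ ℤ.+ a)) ≡ ⊖ Id
glue-matrix e a b c d Y Z S≡ T≡ = begin
  (((Y ⊗ A (b ℤ.+ 1ℤ)) ⊗ A (1ℤ ℤ.+ d)) ⊗ Z) ⊗ A (c ℤ.+ (1ℤ ℤ.+ a))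
    ≡⟨ cong₂ (λ B D → (((Y ⊗ B) ⊗ D) ⊗ Z) ⊗ A (c ℤ.+ (1ℤ ℤ.+ a))) (A-+ b 1ℤ) (A-+ 1ℤ d) ⟩
  (((Y ⊗ ((A b ⊗ J) ⊗ A 1ℤ)) ⊗ ((A 1ℤ ⊗ J) ⊗ A d)) ⊗ Z) ⊗ A (c ℤ.+ (1ℤ ℤ.+ a))
    ≡⟨ cong (λ C → (((Y ⊗ ((A b ⊗ J) ⊗ A 1ℤ)) ⊗ ((A 1ℤ ⊗ J) ⊗ A d)) ⊗ Z) ⊗ C)
         (trans (A-+ c (1ℤ ℤ.+ a)) (cong ((A c ⊗ J) ⊗_) (A-+ 1ℤ a))) ⟩
  (((Y ⊗ ((A b ⊗ J) ⊗ A 1ℤ)) ⊗ ((A 1ℤ ⊗ J) ⊗ A d)) ⊗ Z) ⊗ ((A c ⊗ J) ⊗ ((A 1ℤ ⊗ J) ⊗ A a))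
    ≡⟨ reassoc-glue Y (A b) J (A 1ℤ) (A d) Z (A c) (A a) ⟩
  ((Y ⊗ A b) ⊗ (((((J ⊗ A 1ℤ) ⊗ A 1ℤ) ⊗ J) ⊗ ((A d ⊗ Z) ⊗ A c)) ⊗ (J ⊗ (A 1ℤ ⊗ J)))) ⊗ A a
    ≡⟨ cong (λ X → ((Y ⊗ A b) ⊗ (((((J ⊗ A 1ℤ) ⊗ A 1ℤ) ⊗ J) ⊗ X) ⊗ (J ⊗ (A 1ℤ ⊗ J)))) ⊗ A a) T≡ ⟩
  ((Y ⊗ A b) ⊗ (((((J ⊗ A 1ℤ) ⊗ A 1ℤ) ⊗ J) ⊗ ⊖^ e Id) ⊗ (J ⊗ (A 1ℤ ⊗ J)))) ⊗ A a
    -- The rest of the middle factor is J A(1)³ J = -J² = Id, which holds by evaluation.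
    ≡⟨ cong (λ X → ((Y ⊗ A b) ⊗ X) ⊗ A a) (J-⊖^-J e ((J ⊗ A 1ℤ) ⊗ A 1ℤ) (A 1ℤ ⊗ J)) ⟩
  ((Y ⊗ A b) ⊗ ⊖^ (suc e) Id) ⊗ A a
    ≡⟨ cong (_⊗ A a) (⊗-⊖^ (suc e) (Y ⊗ A b) Id) ⟩
  ⊖^ (suc e) ((Y ⊗ A b) ⊗ Id) ⊗ A a
    ≡⟨ ⊖^-⊗ (suc e) _ (A a) ⟩
  ⊖^ (suc e) (((Y ⊗ A b) ⊗ Id) ⊗ A a)
    ≡⟨ cong (λ X → ⊖^ (suc e) (X ⊗ A a)) (⊗-identityʳ (Y ⊗ A b)) ⟩
  ⊖^ (suc e) ((Y ⊗ A b) ⊗ A a)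
    ≡⟨ cong (⊖^ (suc e)) S≡ ⟩
  ⊖ ⊖^ e (⊖^ e Id)
    -- The equal parity of the two dissections enters here: both signs have the exponent `e`, so
    -- they cancel.
    ≡⟨ cong ⊖_ (⊖^-involutive e Id) ⟩
  ⊖ Id ∎
  where open ≡-Reasoning

-- The vertices of `a` and `c` are identified, whence N + L - 1 vertices. The triangle joins this
-- vertex to those of `d` and `b`; it shares the side at `a`, `b` with the first polygon and the
-- side at `c`, `d` with the second.
glue : ∀ {e N L} a b ys c zs d →
  Solution e N (a ∷ b ∷ ys) → Solution e L (c ∷ zs ++ [ d ]) →
  Solution 1 (N + L ∸ 1) (a + c + 1 ∷ zs ++ (d + 1) ∷ (b + 1) ∷ ys)
glue {e} a b ys c zs d (refl , a>0 ∷ b>0 ∷ ys>0 , S≡) (refl , c>0 ∷ zsd>0 , T≡) =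
  len , +1>0 (a + c) ∷ All.++⁺ (All.++⁻ˡ zs zsd>0) (+1>0 d ∷ +1>0 b ∷ ys>0) , prod
  where
  open ≡-Reasoning
  +1>0 : ∀ x → 0 < x + 1
  +1>0 x = ℕ.m≤n+m 1 x
  Y = M (map ℤ.+_ ys)
  Z = M (map ℤ.+_ zs)
  len : suc (length (zs ++ (d + 1) ∷ (b + 1) ∷ ys)) ≡ suc (length ys) + suc (length (zs ++ [ d ]))
  len = begin
    suc (length (zs ++ (d + 1) ∷ (b + 1) ∷ ys))          ≡⟨ cong suc (List.length-++ zs) ⟩
    suc (length zs + suc (suc (length ys)))              ≡⟨ arith (length zs) (length ys) ⟩
    suc (length ys) + suc (length zs + 1)                ≡⟨ cong (λ l → suc (length ys) + suc l) (List.length-++ zs) ⟨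
    suc (length ys) + suc (length (zs ++ [ d ]))         ∎
    where
    arith : ∀ z y → suc (z + suc (suc y)) ≡ suc y + suc (z + 1)
    arith = solveℕ-∀
  T≡′ : (A (ℤ.+ d) ⊗ Z) ⊗ A (ℤ.+ c) ≡ ⊖^ e Id
  T≡′ = begin
    (A (ℤ.+ d) ⊗ Z) ⊗ A (ℤ.+ c)            ≡⟨ cong (λ X → (X ⊗ Z) ⊗ A (ℤ.+ c)) (⊗-identityˡ (A (ℤ.+ d))) ⟨
    ((Id ⊗ A (ℤ.+ d)) ⊗ Z) ⊗ A (ℤ.+ c)     ≡⟨ cong (_⊗ A (ℤ.+ c)) (M-++ (map ℤ.+_ zs) [ ℤ.+ d ]) ⟨
    M (map ℤ.+_ zs ++ [ ℤ.+ d ]) ⊗ A (ℤ.+ c) ≡⟨ cong (λ X → M X ⊗ A (ℤ.+ c)) (List.map-++ ℤ.+_ zs [ d ]) ⟨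
    M (map ℤ.+_ (zs ++ [ d ])) ⊗ A (ℤ.+ c) ≡⟨ T≡ ⟩
    ⊖^ e Id ∎
  arith₃ : ∀ a c → a + c + 1 ≡ c + (1 + a)
  arith₃ = solveℕ-∀
  prod : M (map ℤ.+_ (a + c + 1 ∷ zs ++ (d + 1) ∷ (b + 1) ∷ ys)) ≡ ⊖^ 1 Id
  prod = begin
    M (map ℤ.+_ (zs ++ (d + 1) ∷ (b + 1) ∷ ys)) ⊗ A (ℤ.+ (a + c + 1))
      ≡⟨ cong₂ (λ l x → M l ⊗ A (ℤ.+ x)) (List.map-++ ℤ.+_ zs _) (arith₃ a c) ⟩
    M (map ℤ.+_ zs ++ map ℤ.+_ ((d + 1) ∷ (b + 1) ∷ ys)) ⊗ A (ℤ.+ (c + (1 + a)))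
      ≡⟨ cong (_⊗ A (ℤ.+ (c + (1 + a)))) (M-++ (map ℤ.+_ zs) _) ⟩
    (((Y ⊗ A (ℤ.+ (b + 1))) ⊗ A (ℤ.+ (d + 1))) ⊗ Z) ⊗ A (ℤ.+ (c + (1 + a)))
      ≡⟨ cong (λ x → (((Y ⊗ A (ℤ.+ (b + 1))) ⊗ A (ℤ.+ x)) ⊗ Z) ⊗ A (ℤ.+ (c + (1 + a)))) (ℕ.+-comm d 1) ⟩
    (((Y ⊗ A (ℤ.+ b ℤ.+ 1ℤ)) ⊗ A (1ℤ ℤ.+ ℤ.+ d)) ⊗ Z) ⊗ A (ℤ.+ c ℤ.+ (1ℤ ℤ.+ ℤ.+ a))
      ≡⟨ glue-matrix e (ℤ.+ a) (ℤ.+ b) (ℤ.+ c) (ℤ.+ d) Y Z S≡ T≡′ ⟩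
    ⊖ Id ∎

-- Evaluating the products on sequences split at the glued side.

length-snoc : ∀ (xs : List ℕ) x → length (xs ++ [ x ]) ≡ suc (length xs)
length-snoc xs x = List.length-++-comm xs [ x ]

‼-++ : ∀ xs a ys → (xs ++ a ∷ ys) ‼ suc (length xs) ≡ a
‼-++ []       a ys = refl
‼-++ (x ∷ xs) a ys = ‼-++ xs a ys

‼-next : ∀ xs a b ys → (xs ++ a ∷ b ∷ ys) ‼ suc (suc (length xs)) ≡ b
‼-next xs a b ys =
  trans (cong₂ _‼_ (sym (List.++-assoc xs [ a ] (b ∷ ys))) (cong suc (sym (length-snoc xs a))))
    (‼-++ (xs ++ [ a ]) b ys)

take-length : ∀ (xs ys : List ℕ) → take (length xs) (xs ++ ys) ≡ xs
take-length []       ys = refl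
take-length (x ∷ xs) ys = cong (x ∷_) (take-length xs ys)

infixr 5 _⊕_

_⊕_ : ∀ {ws xs ys zs : List ℕ} → ws ≡ xs → ys ≡ zs → ws ++ ys ≡ xs ++ zs
_⊕_ = cong₂ _++_

module _ (a : ℕ) (xs : List ℕ) (b : ℕ) where
  private
    s : List ℕ
    s = a ∷ xs ++ [ b ]

  snoc-last : s ‼ length s ≡ b
  snoc-last = trans (cong (s ‼_) (cong suc (length-snoc xs b))) (‼-++ xs b [])

  snoc-inner : s ⟨ 2 ⋯ length s ∸ 1 ⟩ ≡ xs
  snoc-inner = trans (cong (λ l → take (l ∸ 1) (xs ++ [ b ])) (length-snoc xs b)) (take-length xs [ b ])

suffix : ∀ xs p q (ys : List ℕ) →
  (xs ++ p ∷ q ∷ ys) ⟨ suc (length xs) + 2 ⋯ length (xs ++ p ∷ q ∷ ys) ⟩ ≡ ys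
suffix []       p q ys = List.take-all (length ys) ys ℕ.≤-refl
suffix (x ∷ []) p q ys = suffix [] p q ys
suffix (x ∷ y ∷ xs) p q ys = suffix (y ∷ xs) p q ys

if-true : ∀ {b} {x y : List ℕ} → T b → (if b then x else y) ≡ x
if-true {true} _ = refl

if-false : ∀ {b} {x y : List ℕ} → ¬ T b → (if b then x else y) ≡ y
if-false {true}  ¬t = contradiction _ ¬t
if-false {false} _  = refl

∘-interior : ∀ xs a b ys c zs d →
  (xs ++ a ∷ b ∷ ys) ∘[ suc (length xs) ] (c ∷ zs ++ [ d ]) ≡
  xs ++ (a + c + 1) ∷ zs ++ (d + 1) ∷ (b + 1) ∷ ys
∘-interior xs a b ys c zs d = trans (if-true (ℕ.<⇒<ᵇ lt)) body
  where
  lt : suc (length xs) < length (xs ++ a ∷ b ∷ ys)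
  lt = subst (suc (length xs) <_) (sym (List.length-++ xs))
         (subst (_≤ length xs + suc (suc (length ys))) (ℕ.+-comm (length xs) 2)
           (ℕ.+-monoʳ-≤ (length xs) (s≤s (s≤s z≤n))))
  body = take-length xs (a ∷ b ∷ ys)
     ⊕ cong₂ (λ x y → [ x + y + 1 ]) (‼-++ xs a (b ∷ ys)) refl
     ⊕ snoc-inner c zs d
     ⊕ cong (λ x → [ x + 1 ]) (snoc-last c zs d)
     ⊕ cong (λ x → [ x + 1 ])
         (trans (cong ((xs ++ a ∷ b ∷ ys) ‼_) (ℕ.+-comm (suc (length xs)) 1)) (‼-next xs a b ys))
     ⊕ suffix xs a b ys

∘-last : ∀ a xs b c zs d → let s = a ∷ xs ++ [ b ] in
  s ∘[ length s ] (c ∷ zs ++ [ d ]) ≡ (a + 1) ∷ xs ++ (b + c + 1) ∷ zs ++ [ d + 1 ]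
∘-last a xs b c zs d = trans (if-false λ lt → ℕ.<-irrefl refl (ℕ.<ᵇ⇒< n n lt)) body
  where
  n = length (a ∷ xs ++ [ b ])
  body = cong ((a + 1) ∷_)
      (snoc-inner a xs b
     ⊕ cong (λ x → [ x + c + 1 ]) (snoc-last a xs b)
     ⊕ snoc-inner c zs d
     ⊕ cong (λ x → [ x + 1 ]) (snoc-last c zs d))

•-first : ∀ a xs b c d ts →
  (a ∷ xs ++ [ b ]) •[ 1 ] (c ∷ d ∷ ts) ≡ (a + c + 1) ∷ xs ++ (b + 1) ∷ (d + 1) ∷ ts
•-first a xs b c d ts = cong ((a + c + 1) ∷_)
    (snoc-inner a xs b
   ⊕ cong (λ x → [ x + 1 ]) (snoc-last a xs b)
   ⊕ cong ((d + 1) ∷_) (List.take-all (length ts) ts ℕ.≤-refl))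

•-interior : ∀ xs b a ys c d ts →
  (xs ++ b ∷ a ∷ ys) •[ suc (suc (length xs)) ] (c ∷ d ∷ ts) ≡
  xs ++ (b + 1) ∷ (d + 1) ∷ ts ++ (a + c + 1) ∷ ys
•-interior xs b a ys c d ts =
     take-length xs (b ∷ a ∷ ys)
   ⊕ cong (λ x → [ x + 1 ]) (‼-++ xs b (a ∷ ys))
   ⊕ cong ((d + 1) ∷_)
      (List.take-all (length ts) ts ℕ.≤-refl
     ⊕ cong (λ x → [ x + c + 1 ]) (‼-next xs b a ys)
     ⊕ trans (cong (λ k → (xs ++ b ∷ a ∷ ys) ⟨ suc k ⋯ length (xs ++ b ∷ a ∷ ys) ⟩) (sym (ℕ.+-suc (length xs) 1)))
         (suffix xs b a ys))

split : ∀ (s : List ℕ) k → suc k < length s →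
  ∃₂ λ xs a → ∃₂ λ b ys → s ≡ xs ++ a ∷ b ∷ ys × length xs ≡ k
split (a ∷ b ∷ ys) zero    lt = [] , a , b , ys , refl , refl
split (a ∷ [])     zero    (s≤s ())
split (x ∷ s)      (suc k) lt with xs , a , b , ys , s≡ , len ← split s k (ℕ.≤-pred lt) =
  x ∷ xs , a , b , ys , cong (x ∷_) s≡ , cong suc len

ends : ∀ (s : List ℕ) → 2 ≤ length s → ∃₂ λ a xs → ∃ λ b → s ≡ a ∷ xs ++ [ b ]
ends (a ∷ s) le with initLast s
ends (a ∷ .[]) (s≤s ()) | []
ends (a ∷ .(xs ++ [ b ])) le | xs ∷ʳ′ b = a , xs , b , refl

starts : ∀ (s : List ℕ) → 2 ≤ length s → ∃₂ λ a b → ∃ λ xs → s ≡ a ∷ b ∷ xs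
starts (a ∷ b ∷ xs) le = a , b , xs , refl
starts (a ∷ [])     (s≤s ())

-- Moving `xs` to the end brings `a` and `b` to the front, where `glue` applies; afterwards `xs` is
-- moved back.
∘-interior-solution : ∀ {e N L} xs a b ys c zs d →
  Solution e N (xs ++ a ∷ b ∷ ys) → Solution e L (c ∷ zs ++ [ d ]) →
  Solution 1 (N + L ∸ 1) (xs ++ (a + c + 1) ∷ zs ++ (d + 1) ∷ (b + 1) ∷ ys)
∘-interior-solution {e} {N} {L} xs a b ys c zs d S T =
  rotate {1} ((a + c + 1) ∷ zs ++ (d + 1) ∷ (b + 1) ∷ ys) xs
    (subst (λ l → Solution 1 (N + L ∸ 1) ((a + c + 1) ∷ l))
      (sym (List.++-assoc zs ((d + 1) ∷ (b + 1) ∷ ys) xs))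
      (glue a b (ys ++ xs) c zs d (rotate xs (a ∷ b ∷ ys) S) T))

-- The glued side joins the last vertex to the first, so the rotation puts `b` in front of `a`.
∘-last-solution : ∀ {e N L} a xs b c zs d →
  Solution e N (a ∷ xs ++ [ b ]) → Solution e L (c ∷ zs ++ [ d ]) →
  Solution 1 (N + L ∸ 1) ((a + 1) ∷ xs ++ (b + c + 1) ∷ zs ++ [ d + 1 ])
∘-last-solution {e} {N} {L} a xs b c zs d S T =
  rotate {1} ((b + c + 1) ∷ zs ++ [ d + 1 ]) ((a + 1) ∷ xs)
    (subst (λ l → Solution 1 (N + L ∸ 1) ((b + c + 1) ∷ l))
      (sym (List.++-assoc zs [ d + 1 ] ((a + 1) ∷ xs)))
      (glue b a xs c zs d (rotate (a ∷ xs) [ b ] S) T))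

-- The products • are ∘ with the two factors exchanged, up to rotation.
•-first-solution : ∀ {e N L} a xs b c d ts →
  Solution e N (a ∷ xs ++ [ b ]) → Solution e L (c ∷ d ∷ ts) →
  Solution 1 (N + L ∸ 1) ((a + c + 1) ∷ xs ++ (b + 1) ∷ (d + 1) ∷ ts)
•-first-solution {e} {N} {L} a xs b c d ts S T =
  subst₂ (λ N x → Solution 1 (N ∸ 1) (x + 1 ∷ xs ++ (b + 1) ∷ (d + 1) ∷ ts))
    (ℕ.+-comm L N) (ℕ.+-comm c a) (glue c d ts a xs b T S)

-- Rotating `S` until `a` comes first and `b` last reduces this to the product at k = 1.
•-interior-solution : ∀ {e N L} xs b a ys c d ts →
  Solution e N (xs ++ b ∷ a ∷ ys) → Solution e L (c ∷ d ∷ ts) →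
  Solution 1 (N + L ∸ 1) (xs ++ (b + 1) ∷ (d + 1) ∷ ts ++ (a + c + 1) ∷ ys)
•-interior-solution {e} {N} {L} xs b a ys c d ts S T =
  subst (Solution 1 (N + L ∸ 1)) (List.++-assoc xs ((b + 1) ∷ (d + 1) ∷ ts) ((a + c + 1) ∷ ys))
    (rotate {1} ((a + c + 1) ∷ ys) (xs ++ (b + 1) ∷ (d + 1) ∷ ts)
      (subst (λ l → Solution 1 (N + L ∸ 1) ((a + c + 1) ∷ l)) (List.++-assoc ys xs _)
        (•-first-solution a (ys ++ xs) b c d ts S′ T)))
  where
  S′ : Solution e N (a ∷ (ys ++ xs) ++ [ b ])
  S′ = subst (λ l → Solution e N (a ∷ l)) (sym (List.++-assoc ys xs [ b ]))
         (rotate (xs ++ [ b ]) (a ∷ ys)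
           (subst (Solution e N) (sym (List.++-assoc xs [ b ] (a ∷ ys))) S))

∘-solution : ∀ {e N L s t} → 2 ≤ N → 2 ≤ L → Solution e N s → Solution e L t →
  ∀ k → 1 ≤ k → k ≤ N → IsPositiveSolution (N + L ∸ 1) (s ∘[ k ] t)
∘-solution {e} {N} {L} {s} {t} 2≤N 2≤L S@(refl , _) T@(refl , _) (suc k) _ k<N
  with c , zs , d , refl ← ends t 2≤L | ℕ.m≤n⇒m<n∨m≡n k<N
... | inj₁ k+1<N with xs , a , b , ys , refl , refl ← split s k k+1<N =
  subst (IsPositiveSolution _) (sym (∘-interior xs a b ys c zs d)) (∘-interior-solution xs a b ys c zs d S T)
... | inj₂ k+1≡N with a , xs , b , refl ← ends s 2≤N =
  subst (IsPositiveSolution _)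
    (trans (sym (∘-last a xs b c zs d)) (cong (s ∘[_] t) (sym k+1≡N)))
    (∘-last-solution a xs b c zs d S T)

•-solution : ∀ {e N L s t} → 2 ≤ N → 2 ≤ L → Solution e N s → Solution e L t →
  ∀ k → 1 ≤ k → k ≤ N → IsPositiveSolution (N + L ∸ 1) (s •[ k ] t)
•-solution {s = s} {t} 2≤N 2≤L S@(refl , _) T@(refl , _) (suc k) _ k<N
  with c , d , ts , refl ← starts t 2≤L | k
... | zero  with a , xs , b , refl ← ends s 2≤N =
  subst (IsPositiveSolution _) (sym (•-first a xs b c d ts)) (•-first-solution a xs b c d ts S T)
... | suc k with xs , b , a , ys , refl , refl ← split s k k<N =
  subst (IsPositiveSolution _) (sym (•-interior xs b a ys c d ts)) (•-interior-solution xs b a ys c d ts S T)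

-- Counting subsets of the vertices

module _ {X : Set} where

  length-filter-⊎ : {P Q R : X → Set} (P? : Decidable P) (Q? : Decidable Q) (R? : Decidable R) →
    (∀ {x} → P x → Q x ⊎ R x) → (∀ {x} → Q x → P x) → (∀ {x} → R x → P x) →
    (∀ {x} → Q x → ¬ R x) → ∀ xs →
    length (filter P? xs) ≡ length (filter Q? xs) + length (filter R? xs)
  length-filter-⊎ P? Q? R? P⇒ Q⇒P R⇒P disj [] = refl
  length-filter-⊎ P? Q? R? P⇒ Q⇒P R⇒P disj (x ∷ xs)
    with ih ← length-filter-⊎ P? Q? R? P⇒ Q⇒P R⇒P disj xs | P? x | Q? x | R? x
  ... | _     | yes q | yes r = contradiction r (disj q)
  ... | yes p | yes q | no  _ = cong suc ih
  ... | yes p | no  _ | yes r = trans (cong suc ih) (sym (ℕ.+-suc _ _))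
  ... | yes p | no ¬q | no ¬r = contradiction (P⇒ p) Sum.[ ¬q , ¬r ]
  ... | no ¬p | yes q | no  _ = contradiction (Q⇒P q) ¬p
  ... | no ¬p | no  _ | yes r = contradiction (R⇒P r) ¬p
  ... | no  _ | no  _ | no  _ = ih

  filter-filter : {P Q : X → Set} (P? : Decidable P) (Q? : Decidable Q) → ∀ xs →
    filter P? (filter Q? xs) ≡ filter (λ x → Q? x ×-dec P? x) xs
  filter-filter P? Q? [] = refl
  filter-filter P? Q? (x ∷ xs) with ih ← filter-filter P? Q? xs | Q? x
  ... | no _ = ih
  ... | yes _ with P? x
  ...   | yes _ = cong (x ∷_) ih
  ...   | no  _ = ih

  length-filter-map : {Y : Set} {P : X → Set} (P? : Decidable P) (f : Y → X) → ∀ ys →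
    length (filter P? (map f ys)) ≡ length (filter (P? ∘ f) ys)
  length-filter-map P? f [] = refl
  length-filter-map P? f (y ∷ ys) with ih ← length-filter-map P? f ys | does (P? (f y))
  ... | true  = cong suc ih
  ... | false = ih

opaque

  -- Opaque, so that the enumeration of all subsets is not unfolded in later goals;
  -- `count≡length-filter` gives access to the definition.
  count : ∀ {n} {P : Subset n → Set} → Decidable P → ℕ
  count {n} P? = length (filter P? (subsets n))

  ∈-subsets : ∀ {n} (V : Subset n) → V ListMem.∈ subsets n
  ∈-subsets [] = here refl
  ∈-subsets {suc n} (inside  ∷ V) = ListMem.∈-++⁺ˡ (ListMem.∈-map⁺ (inside ∷_) (∈-subsets V))
  ∈-subsets {suc n} (outside ∷ V) =
    ListMem.∈-++⁺ʳ (map (inside ∷_) (subsets n)) (ListMem.∈-map⁺ (outside ∷_) (∈-subsets V))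

  count-⊎ : ∀ {n} {P Q R : Subset n → Set} (P? : Decidable P) (Q? : Decidable Q) (R? : Decidable R) →
    (∀ {V} → P V → Q V ⊎ R V) → (∀ {V} → Q V → P V) → (∀ {V} → R V → P V) →
    (∀ {V} → Q V → ¬ R V) → count P? ≡ count Q? + count R?
  count-⊎ {n} P? Q? R? P⇒ Q⇒P R⇒P disj = length-filter-⊎ P? Q? R? P⇒ Q⇒P R⇒P disj (subsets n)

  count-cong : ∀ {n} {P Q : Subset n → Set} (P? : Decidable P) (Q? : Decidable Q) →
    (∀ {V} → P V → Q V) → (∀ {V} → Q V → P V) → count P? ≡ count Q?
  count-cong {n} P? Q? P⇒Q Q⇒P = cong length (List.filter-≐ P? Q? (P⇒Q , Q⇒P) (subsets n))

  count-none : ∀ {n} {P : Subset n → Set} (P? : Decidable P) → (∀ {V} → ¬ P V) → count P? ≡ 0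
  count-none {n} P? ¬P = cong length (List.filter-none P? (All.universal (λ V → ¬P {V}) (subsets n)))

  count-some : ∀ {n} {P : Subset n → Set} (P? : Decidable P) {V} → P V → 0 < count P?
  count-some P? {V} p = List.filter-some P? (ListMem.lose (∈-subsets V) p)

  count-suc : ∀ {n} {P : Subset (suc n) → Set} (P? : Decidable P) →
    count P? ≡ count (P? ∘ (inside ∷_)) + count (P? ∘ (outside ∷_))
  count-suc {n} P? = begin
    length (filter P? (map (inside ∷_) Vs ++ map (outside ∷_) Vs))
      ≡⟨ cong length (List.filter-++ P? (map (inside ∷_) Vs) _) ⟩
    length (filter P? (map (inside ∷_) Vs) ++ filter P? (map (outside ∷_) Vs))
      ≡⟨ List.length-++ (filter P? (map (inside ∷_) Vs)) ⟩
    length (filter P? (map (inside ∷_) Vs)) + length (filter P? (map (outside ∷_) Vs))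
      ≡⟨ cong₂ _+_ (length-filter-map P? (inside ∷_) Vs) (length-filter-map P? (outside ∷_) Vs) ⟩
    count (P? ∘ (inside ∷_)) + count (P? ∘ (outside ∷_)) ∎
    where
    open ≡-Reasoning
    Vs : List (Subset n)
    Vs = subsets n

  count-one : ∀ {n} {P : Subset n → Set} (P? : Decidable P) V → P V → (∀ {W} → P W → W ≡ V) → count P? ≡ 1
  count-one P? [] p unique = cong length (List.filter-accept P? {xs = []} p)
  count-one P? (inside ∷ V) p unique = trans (count-suc P?) (cong₂ _+_
    (count-one (P? ∘ (inside ∷_)) V p λ q → Vec.∷-injectiveʳ (unique q))
    (count-none (P? ∘ (outside ∷_)) λ q → contradiction (Vec.∷-injectiveˡ (unique q)) λ ()))
  count-one P? (outside ∷ V) p unique = trans (count-suc P?) (cong₂ _+_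
    (count-none (P? ∘ (inside ∷_)) λ q → contradiction (Vec.∷-injectiveˡ (unique q)) λ ())
    (count-one (P? ∘ (outside ∷_)) V p λ q → Vec.∷-injectiveʳ (unique q)))

  count≡length-filter : ∀ {n} {P : Subset n → Set} (P? : Decidable P) →
    count P? ≡ length (filter P? (subsets n))
  count≡length-filter P? = refl

opaque

  least : ∀ {n} {P : Fin n → Set} → Decidable P → ∃ P → ∃ λ x → P x × (∀ {y} → P y → x Fin.≤ y)
  least P? (suc x , p) with P? zero
  ... | yes p₀ = zero , p₀ , λ _ → z≤n
  ... | no ¬p₀ with y , q , min ← least (P? ∘ suc) (x , p) =
    suc y , q , λ { {zero} p₀ → contradiction p₀ ¬p₀ ; {suc _} r → s≤s (min r) }
  least P? (zero , p) = zero , p , λ _ → z≤n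

  greatest : ∀ {n} {P : Fin n → Set} → Decidable P → ∃ P → ∃ λ x → P x × (∀ {y} → P y → y Fin.≤ x)
  greatest {suc n} P? (x , p) with Fin.any? (P? ∘ suc)
  ... | yes q with y , r , max ← greatest (P? ∘ suc) q =
    suc y , r , λ { {zero} _ → z≤n ; {suc _} s → s≤s (max s) }
  greatest {suc n} P? (zero , p)  | no ¬q = zero , p , λ { {zero} _ → z≤n ; {suc y} r → contradiction (y , r) ¬q }
  greatest {suc n} P? (suc x , p) | no ¬q = contradiction (x , p) ¬q

∣⁅x⁆∪p∣≤ : ∀ {n} x (p : Subset n) → ∣ ⁅ x ⁆ ∪ p ∣ ≤ suc ∣ p ∣
∣⁅x⁆∪p∣≤ zero (y ∷ p) rewrite Subset.∪-identityˡ p = s≤s (Subset.∣p∣≤∣x∷p∣ y p)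
∣⁅x⁆∪p∣≤ (suc x) (inside  ∷ p) = s≤s (∣⁅x⁆∪p∣≤ x p)
∣⁅x⁆∪p∣≤ (suc x) (outside ∷ p) = ∣⁅x⁆∪p∣≤ x p

opaque

  -- Otherwise `W` would be contained in the set of `a` and `b`. With `a` and `b` equal it merely
  -- provides a vertex different from `a`.
  third : ∀ {n} {W : Subset n} → 3 ≤ ∣ W ∣ → ∀ a b → ∃ λ u → u ∈ W × u ≢ a × u ≢ b
  third {W = W} 3≤ a b with Fin.any? (λ u → u ∈? W ×-dec ¬? (u Fin.≟ a) ×-dec ¬? (u Fin.≟ b))
  ... | yes found = found
  ... | no ¬found = contradiction (ℕ.≤-trans 3≤ ∣W∣≤2) λ { (s≤s (s≤s ())) }
    where
    W⊆ : ∀ {u} → u ∈ W → u ∈ ⁅ a ⁆ ∪ ⁅ b ⁆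
    W⊆ {u} u∈W with u Fin.≟ a | u Fin.≟ b
    ... | yes refl | _        = Subset.x∈p∪q⁺ (inj₁ (Subset.x∈⁅x⁆ u))
    ... | no  _    | yes refl = Subset.x∈p∪q⁺ (inj₂ (Subset.x∈⁅x⁆ u))
    ... | no  u≢a  | no u≢b   = contradiction (u , u∈W , u≢a , u≢b) ¬found
    ∣W∣≤2 : ∣ W ∣ ≤ 2
    ∣W∣≤2 = ℕ.≤-trans (Subset.p⊆q⇒∣p∣≤∣q∣ W⊆)
      (subst (λ c → ∣ ⁅ a ⁆ ∪ ⁅ b ⁆ ∣ ≤ suc c) (Subset.∣⁅x⁆∣≡1 b) (∣⁅x⁆∪p∣≤ a ⁅ b ⁆))

three : ∀ {n} {V : Subset n} {x y z} → x ∈ V → y ∈ V → z ∈ V → x Fin.< y → y Fin.< z → 3 ≤ ∣ V ∣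
three {V = V} {x} {y} {z} x∈ y∈ z∈ x<y y<z =
  ℕ.≤-trans (s≤s (ℕ.≤-trans (s≤s (ℕ.≤-trans (s≤s z≤n)
    (Subset.x∈p⇒∣p-x∣<∣p∣ z∈V-x-y))) (Subset.x∈p⇒∣p-x∣<∣p∣ y∈V-x))) (Subset.x∈p⇒∣p-x∣<∣p∣ x∈)
  where
  y∈V-x : y ∈ V - x
  y∈V-x = Subset.x∈p∧x≢y⇒x∈p-y y∈ (Fin.<⇒≢ x<y ∘ sym)
  z∈V-x-y : z ∈ V - x - y
  z∈V-x-y = Subset.x∈p∧x≢y⇒x∈p-y
    (Subset.x∈p∧x≢y⇒x∈p-y z∈ (Fin.<⇒≢ (ℕ.<-trans x<y y<z) ∘ sym)) (Fin.<⇒≢ y<z ∘ sym)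

opaque

  ⟦_⟧ : ∀ {n} {P : Fin n → Set} → Decidable P → Subset n
  ⟦ P? ⟧ = Vec.tabulate (λ x → does (P? x))

  ∈⟦⟧⁺ : ∀ {n} {P : Fin n → Set} (P? : Decidable P) {x} → P x → x ∈ ⟦ P? ⟧
  ∈⟦⟧⁺ P? {x} p = Vec.lookup⇒[]= x _ (trans (Vec.lookup∘tabulate _ x) (dec-true (P? x) p))

  ∈⟦⟧⁻ : ∀ {n} {P : Fin n → Set} (P? : Decidable P) {x} → x ∈ ⟦ P? ⟧ → P x
  ∈⟦⟧⁻ P? {x} x∈ with P? x | trans (sym (Vec.lookup∘tabulate (λ y → does (P? y)) x)) (Vec.[]=⇒lookup x∈)
  ... | yes p | _  = p
  ... | no  _ | ()

-- Matrix products attached to a set of vertices.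

infix 4 _∈ᴺ_ _∈ᴺ?_

-- Natural numbers as vertices, since ∏ runs over an interval of ℕ.
_∈ᴺ_ : ∀ {n} → ℕ → Subset n → Set
k ∈ᴺ V = ∃ λ x → toℕ x ≡ k × x ∈ V

_∈ᴺ?_ : ∀ {n} k (V : Subset n) → Dec (k ∈ᴺ V)
k ∈ᴺ? V = Fin.any? λ x → toℕ x ℕ.≟ k ×-dec x ∈? V

-- The contribution of a single sub-polygon, which adds 1 to the term at each of its vertices.
-- Indices beyond the last vertex give `Id`.
factor : ∀ {n} → Subset n → ℕ → Mat₂
factor []            k       = Id
factor (_       ∷ V) (suc k) = factor V k
factor (inside  ∷ V) zero    = A 1ℤ
factor (outside ∷ V) zero    = Id

factor-∈ : ∀ {n} {V : Subset n} {x} → x ∈ V → factor V (toℕ x) ≡ A 1ℤ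
factor-∈ here       = refl
factor-∈ (there x∈) = factor-∈ x∈

factor-∉ : ∀ {n} (V : Subset n) k → ¬ (k ∈ᴺ V) → factor V k ≡ Id
factor-∉ []            k       k∉ = refl
factor-∉ (inside  ∷ V) zero    k∉ = contradiction (zero , refl , here) k∉
factor-∉ (outside ∷ V) zero    k∉ = refl
factor-∉ (_       ∷ V) (suc k) k∉ = factor-∉ V k λ { (x , x≡k , x∈) → k∉ (suc x , cong suc x≡k , there x∈) }

∏-shift : ∀ F i m → ∏ F (suc i) m ≡ ∏ (F ∘ suc) i m
∏-shift F i zero    = refl
∏-shift F i (suc m) = cong (_⊗ F (suc i)) (∏-shift F (suc i) m)

∏-factor : ∀ {n} (V : Subset n) → ∏ (factor V) 0 n ≡ A₁^ ∣ V ∣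
∏-factor [] = refl
∏-factor {suc n} (inside  ∷ V) =
  cong (_⊗ A 1ℤ) (trans (∏-shift (factor (inside ∷ V)) 0 n) (∏-factor V))
∏-factor {suc n} (outside ∷ V) =
  trans (⊗-identityʳ _) (trans (∏-shift (factor (outside ∷ V)) 0 n) (∏-factor V))

⊖^-even : ∀ {e} → 2 ∣ e → ⊖^ e Id ≡ Id
⊖^-even (divides-refl q) = go q
  where
  go : ∀ q → ⊖^ (q * 2) Id ≡ Id
  go zero    = refl
  go (suc q) = cong (λ X → ⊖ ⊖ X) (go q)

⊖^-odd : ∀ {e} → ¬ 2 ∣ e → ⊖^ e Id ≡ ⊖ Id
⊖^-odd {zero}        odd = contradiction (divides-refl 0) odd
⊖^-odd {suc zero}    odd = refl
⊖^-odd {suc (suc e)} odd = cong (λ X → ⊖ ⊖ X) (⊖^-odd {e} λ { (divides-refl q) → odd (divides-refl (suc q)) })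

-- A(1)³ = -Id.
A₁^-3q : ∀ q → A₁^ (q * 3) ≡ ⊖^ q Id
A₁^-3q zero    = refl
A₁^-3q (suc q) rewrite A₁^-3q q = begin
  ((⊖^ q Id ⊗ A 1ℤ) ⊗ A 1ℤ) ⊗ A 1ℤ
    ≡⟨ cong (_⊗ A 1ℤ) (⊗-assoc (⊖^ q Id) (A 1ℤ) (A 1ℤ)) ⟩
  (⊖^ q Id ⊗ (A 1ℤ ⊗ A 1ℤ)) ⊗ A 1ℤ
    ≡⟨ ⊗-assoc (⊖^ q Id) (A 1ℤ ⊗ A 1ℤ) (A 1ℤ) ⟩
  ⊖^ q Id ⊗ (⊖ Id)            ≡⟨ ⊖^-⊗ q Id (⊖ Id) ⟩
  ⊖^ q (⊖ Id)                 ≡⟨ ⊖^-⊖ q Id ⟩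
  ⊖ ⊖^ q Id                   ∎
  where open ≡-Reasoning

2∣q*3⇒2∣q : ∀ q → 2 ∣ q * 3 → 2 ∣ q
2∣q*3⇒2∣q q 2∣q*3 = ∣m+n∣m⇒∣n (subst (2 ∣_) (eq q) 2∣q*3) (n∣m*n q)
  where
  eq : ∀ q → q * 3 ≡ q * 2 + q
  eq q = trans (ℕ.*-suc q 2) (ℕ.+-comm q (q * 2))

-- For c = 3q the power of A(1) is (-1)^q Id, and q has the same parity as 3q.
A₁^-even : ∀ {c} → 3 ∣ c → 2 ∣ c → A₁^ c ≡ Id
A₁^-even (divides-refl q) 2∣c = trans (A₁^-3q q) (⊖^-even (2∣q*3⇒2∣q q 2∣c))

A₁^-odd : ∀ {c} → 3 ∣ c → ¬ 2 ∣ c → A₁^ c ≡ ⊖ Id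
A₁^-odd (divides-refl q) 2∤c = trans (A₁^-3q q) (⊖^-odd λ 2∣q → 2∤c (∣m⇒∣m*n 3 2∣q))

M-tabulate : ∀ {n} (f : Fin n → ℕ) (h : ℕ → ℕ) i → (∀ x → f x ≡ h (toℕ x + i)) →
  M (map ℤ.+_ (tabulate f)) ≡ ∏ (λ k → A (ℤ.+ h k)) i n
M-tabulate {zero}  f h i f≡h = refl
M-tabulate {suc n} f h i f≡h = cong₂ (λ X a → X ⊗ A (ℤ.+ a))
  (M-tabulate (f ∘ suc) h (suc i) λ x → trans (f≡h (suc x)) (cong h (sym (ℕ.+-suc (toℕ x) i))))
  (f≡h zero)

-- One step of the walk along a polygon, from the vertex v to the next vertex
-- w; q counts the sub-polygons cut off by the chord (v , w).
∏-glue : ∀ {g g′ q : ℕ → ℕ} {U : ℕ → Mat₂} {i d v e w x ε} →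
  v ≡ d + i → w ≡ suc e + v →
  (∀ {k} → k < v → g′ k ≡ g k) →
  g′ v ≡ q v + g v →
  (∀ {k} → v < k → k < w → g′ k ≡ q k) →
  g′ w ≡ 1 + q w →
  (∀ {k} → v < k → k < w → U k ≡ Id) →
  U w ≡ A 1ℤ →
  ∏ (λ k → A (ℤ.+ g k)) i (suc d) ≡ ⊖^ x (∏ U i (suc d)) →
  ∏ (λ k → A (ℤ.+ q k)) v (suc (suc e)) ≡ ⊖ ⊖^ ε Id →
  ∏ (λ k → A (ℤ.+ g′ k)) i (suc (d + suc e)) ≡ ⊖^ (x + ε) (∏ U i (suc (d + suc e)))
∏-glue {g} {g′} {q} {U} {i} {d} {v} {e} {w} {x} {ε} refl refl below at-v between at-w U-between U-w prefix chord = begin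
  ∏ G′ i (suc (d + suc e))
    ≡⟨ cong (∏ G′ i) (ℕ.+-suc d (suc e)) ⟨
  ∏ G′ i (d + suc (suc e))
    ≡⟨ ∏-+ G′ i d (suc (suc e)) ⟩
  (∏ G′ (suc v) (suc e) ⊗ G′ v) ⊗ ∏ G′ i d
    ≡⟨ cong₂ (λ X Y → (X ⊗ G′ v) ⊗ Y) new (∏-cong i d λ k _ k<v → cong (λ a → A (ℤ.+ a)) (below k<v)) ⟩
  (((A 1ℤ ⊗ J) ⊗ (Q w ⊗ Qs)) ⊗ G′ v) ⊗ ∏ G i d
    ≡⟨ cong (λ X → (((A 1ℤ ⊗ J) ⊗ (Q w ⊗ Qs)) ⊗ X) ⊗ ∏ G i d)
         (trans (cong (λ a → A (ℤ.+ a)) at-v) (A-+ (ℤ.+ q v) (ℤ.+ g v))) ⟩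
  (((A 1ℤ ⊗ J) ⊗ (Q w ⊗ Qs)) ⊗ ((Q v ⊗ J) ⊗ G v)) ⊗ ∏ G i d
    ≡⟨ cong (_⊗ ∏ G i d) (reassoc-step (A 1ℤ) J (Q w ⊗ Qs) (Q v) (G v)) ⟩
  (((A 1ℤ ⊗ J) ⊗ ((Q w ⊗ Qs) ⊗ Q v)) ⊗ (J ⊗ G v)) ⊗ ∏ G i d
    -- Splitting the terms at `v` and `w` by `A-+` has made the factors of the chord contiguous,
    -- with a `J` on either side.
    ≡⟨ cong (λ X → (((A 1ℤ ⊗ J) ⊗ X) ⊗ (J ⊗ G v)) ⊗ ∏ G i d) chord′ ⟩
  (((A 1ℤ ⊗ J) ⊗ ⊖^ (suc ε) Id) ⊗ (J ⊗ G v)) ⊗ ∏ G i d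
    ≡⟨ cong (_⊗ ∏ G i d) (J-⊖^-J (suc ε) (A 1ℤ) (G v)) ⟩
  ⊖ ⊖ ⊖^ ε (A 1ℤ ⊗ G v) ⊗ ∏ G i d
    -- The sign of J² = -Id cancels the leading sign of the chord product.
    ≡⟨ cong (_⊗ ∏ G i d) (⊖-involutive (⊖^ ε (A 1ℤ ⊗ G v))) ⟩
  ⊖^ ε (A 1ℤ ⊗ G v) ⊗ ∏ G i d
    ≡⟨ ⊖^-⊗ ε (A 1ℤ ⊗ G v) (∏ G i d) ⟩
  ⊖^ ε ((A 1ℤ ⊗ G v) ⊗ ∏ G i d)
    ≡⟨ cong (⊖^ ε) (⊗-assoc (A 1ℤ) (G v) (∏ G i d)) ⟩
  ⊖^ ε (A 1ℤ ⊗ (G v ⊗ ∏ G i d))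
    ≡⟨ cong (λ X → ⊖^ ε (A 1ℤ ⊗ X)) (trans (sym (∏-suc G i d)) prefix) ⟩
  ⊖^ ε (A 1ℤ ⊗ ⊖^ x (∏ U i (suc d)))
    ≡⟨ cong (⊖^ ε) (⊗-⊖^ x (A 1ℤ) (∏ U i (suc d))) ⟩
  ⊖^ ε (⊖^ x (A 1ℤ ⊗ ∏ U i (suc d)))
    ≡⟨ ⊖^-+ ε x (A 1ℤ ⊗ ∏ U i (suc d)) ⟨
  ⊖^ (ε + x) (A 1ℤ ⊗ ∏ U i (suc d))
    ≡⟨ cong₂ ⊖^ (ℕ.+-comm ε x) factors ⟩
  ⊖^ (x + ε) (∏ U i (suc (d + suc e))) ∎
  where
  open ≡-Reasoning
  G  = λ k → A (ℤ.+ g k)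
  G′ = λ k → A (ℤ.+ g′ k)
  Q  = λ k → A (ℤ.+ q k)
  Qs = ∏ Q (suc v) e
  inner : ∀ {k} → k < e + suc v → k < w
  inner {k} = subst (k <_) (ℕ.+-suc e v)
  new : ∏ G′ (suc v) (suc e) ≡ (A 1ℤ ⊗ J) ⊗ (Q w ⊗ Qs)
  new = begin
    ∏ G′ (suc v) (suc e)                     ≡⟨ ∏-suc G′ (suc v) e ⟩
    G′ (e + suc v) ⊗ ∏ G′ (suc v) e          ≡⟨ cong₂ _⊗_ (cong G′ (ℕ.+-suc e v))
                                                  (∏-cong (suc v) e λ k v<k k<w → cong (λ a → A (ℤ.+ a)) (between v<k (inner k<w))) ⟩
    G′ w ⊗ Qs                                ≡⟨ cong (_⊗ Qs) (trans (cong (λ a → A (ℤ.+ a)) at-w) (A-+ 1ℤ (ℤ.+ q w))) ⟩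
    ((A 1ℤ ⊗ J) ⊗ Q w) ⊗ Qs                  ≡⟨ ⊗-assoc (A 1ℤ ⊗ J) (Q w) Qs ⟩
    (A 1ℤ ⊗ J) ⊗ (Q w ⊗ Qs)                  ∎
  chord′ : (Q w ⊗ Qs) ⊗ Q v ≡ ⊖ ⊖^ ε Id
  chord′ = trans (cong (_⊗ Q v) (sym (trans (∏-suc Q (suc v) e) (cong (λ k → Q k ⊗ Qs) (ℕ.+-suc e v))))) chord
  factors : A 1ℤ ⊗ ∏ U i (suc d) ≡ ∏ U i (suc (d + suc e))
  factors = sym (begin
    ∏ U i (suc (d + suc e))                   ≡⟨ ∏-+ U i (suc d) (suc e) ⟩
    ∏ U (suc v) (suc e) ⊗ ∏ U i (suc d)       ≡⟨ cong (_⊗ ∏ U i (suc d)) (∏-suc U (suc v) e) ⟩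
    (U (e + suc v) ⊗ ∏ U (suc v) e) ⊗ ∏ U i (suc d)
      ≡⟨ cong₂ (λ X Y → (X ⊗ Y) ⊗ ∏ U i (suc d)) (trans (cong U (ℕ.+-suc e v)) U-w)
           (∏-Id (suc v) e λ k v<k k<w → U-between v<k (inner k<w)) ⟩
    (A 1ℤ ⊗ Id) ⊗ ∏ U i (suc d)               ∎)

-- The polygon at an edge

module Chords {n} (D : Dissection n) where
  open Dissection D using (Cut; cut?; diagonal; nonCrossing; SubPolygon; subPolygon?; subPolygons) public

  Edge : Fin n → Fin n → Set
  Edge a b = Side ⊤ a b ⊎ Cut a b

  edge? : ∀ a b → Dec (Edge a b)
  edge? a b = side? ⊤ a b ⊎-dec cut? a b

  edge-< : ∀ {a b} → Edge a b → a Fin.< b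
  edge-< (inj₁ (_ , _ , a<b , _)) = a<b
  edge-< (inj₂ cut)               = proj₁ (proj₂ (proj₂ (diagonal cut)))

  edge-suc : ∀ {a b} → toℕ b ≡ suc (toℕ a) → Edge a b
  edge-suc {a} {b} b≡ = inj₁ (Subset.∈⊤ , Subset.∈⊤ , ℕ.≤-reflexive (sym b≡) ,
    inj₁ λ { k _ (a<k , k<b) → ℕ.<-irrefl refl (ℕ.<-≤-trans a<k (ℕ.≤-pred (subst (toℕ k <_) b≡ k<b))) })

  edge-noncrossing : ∀ {a b c d} → Edge a b → Edge c d → ¬ (a Fin.< c × c Fin.< b × b Fin.< d)
  edge-noncrossing (inj₁ (_ , _ , _ , inj₁ none)) _ (a<c , c<b , b<d) = none _ Subset.∈⊤ (a<c , c<b)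
  edge-noncrossing (inj₁ (_ , _ , _ , inj₂ all))  _ (a<c , c<b , b<d) =
    ℕ.<⇒≱ b<d (proj₂ (all _ Subset.∈⊤))
  edge-noncrossing (inj₂ _) (inj₁ (_ , _ , _ , inj₁ none)) (a<c , c<b , b<d) = none _ Subset.∈⊤ (c<b , b<d)
  edge-noncrossing (inj₂ _) (inj₁ (_ , _ , _ , inj₂ all))  (a<c , c<b , b<d) =
    ℕ.<⇒≱ a<c (proj₁ (all _ Subset.∈⊤))
  edge-noncrossing (inj₂ cut) (inj₂ cut′) crossing = nonCrossing cut cut′ crossing

  Within : Fin n → Fin n → Subset n → Set
  Within i j W = ∀ x → x ∈ W → i Fin.≤ x × x Fin.≤ j

  within? : ∀ i j → Decidable (Within i j)
  within? i j W = Fin.all? λ x → x ∈? W →-dec (i Fin.≤? x ×-dec x Fin.≤? j)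

  side⇒edge : ∀ {W x y} → SubPolygon W → Side W x y → Edge x y
  side⇒edge (_ , sides , _) = sides _ _

  -- A side of the n-gon remains a side of every vertex set containing its ends, and a cut cannot be
  -- a diagonal of a sub-polygon.
  edge⇒side : ∀ {W x y} → SubPolygon W → x ∈ W → y ∈ W → Edge x y → Side W x y
  edge⇒side {W} {x} {y} (_ , _ , uncut) x∈ y∈ (inj₁ (_ , _ , x<y , side)) =
    x∈ , y∈ , x<y , Sum.map (λ none k _ → none k Subset.∈⊤) (λ all k _ → all k Subset.∈⊤) side
  edge⇒side {W} {x} {y} (_ , _ , uncut) x∈ y∈ (inj₂ cut) with side? W x y
  ... | yes side = side
  ... | no ¬side = contradiction cut (uncut x y (x∈ , y∈ , proj₁ (proj₂ (proj₂ (diagonal cut))) , ¬side))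

  -- The side of W that separates the vertex a from W.
  record Separation (W : Subset n) (a : Fin n) : Set where
    constructor separation
    field
      {p q}  : Fin n
      side   : Side W p q
      p<a    : p Fin.< a
      a<q    : a Fin.< q
      before : ∀ {x} → x ∈ W → x Fin.≤ a → x Fin.≤ p
      after  : ∀ {x} → x ∈ W → a Fin.≤ x → q Fin.≤ x

  -- The side joins the two neighbours of `a` in `W`: the greatest vertex below `a` and the least
  -- one above.
  separate : ∀ {W a} → a ∉ W → (∃ λ l → l ∈ W × l Fin.≤ a) → (∃ λ r → r ∈ W × a Fin.≤ r) → Separation W a
  separate {W} {a} a∉ below above
    with p , (p∈ , p≤a) , p-max ← greatest (λ l → l ∈? W ×-dec l Fin.≤? a) below
       | q , (q∈ , a≤q) , q-min ← least (λ r → r ∈? W ×-dec a Fin.≤? r) above =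
    separation (p∈ , q∈ , ℕ.<-trans p<a a<q , inj₁ none) p<a a<q
      (λ l∈ l≤a → p-max (l∈ , l≤a)) (λ r∈ a≤r → q-min (r∈ , a≤r))
    where
    p<a : p Fin.< a
    p<a = Fin.≤∧≢⇒< p≤a λ { refl → a∉ p∈ }
    a<q : a Fin.< q
    a<q = Fin.≤∧≢⇒< a≤q λ { refl → a∉ q∈ }
    none : ∀ k → k ∈ W → ¬ (p Fin.< k × k Fin.< q)
    none k k∈ (p<k , k<q) with ℕ.≤-total (toℕ k) (toℕ a)
    ... | inj₁ k≤a = ℕ.<⇒≱ p<k (p-max (k∈ , k≤a))
    ... | inj₂ a≤k = ℕ.<⇒≱ k<q (q-min (k∈ , a≤k))

  -- The polygon on the inner side of the chord (i , j): its vertices are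
  -- those of the interval [i , j] not cut off by another edge.
  module Polygon (i j : Fin n) where

    Proper : Fin n → Fin n → Set
    Proper a b = Edge a b × ¬ (a ≡ i × b ≡ j)

    proper? : ∀ a b → Dec (Proper a b)
    proper? a b = edge? a b ×-dec ¬? (a Fin.≟ i ×-dec b Fin.≟ j)

    Hidden : Fin n → Set
    Hidden x = ∃₂ λ a b → Proper a b × i Fin.≤ a × a Fin.< x × x Fin.< b × b Fin.≤ j

    hidden? : Decidable Hidden
    hidden? x = Fin.any? λ a → Fin.any? λ b →
      proper? a b ×-dec i Fin.≤? a ×-dec a Fin.<? x ×-dec x Fin.<? b ×-dec b Fin.≤? j

    Visible : Fin n → Set
    Visible x = i Fin.≤ x × x Fin.≤ j × ¬ Hidden x

    visible? : Decidable Visible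
    visible? x = i Fin.≤? x ×-dec x Fin.≤? j ×-dec ¬? (hidden? x)

    V : Subset n
    V = ⟦ visible? ⟧

    V-visible : ∀ {x} → x ∈ V → Visible x
    V-visible = ∈⟦⟧⁻ visible?

    V-within : Within i j V
    V-within x x∈ with i≤x , x≤j , _ ← V-visible x∈ = i≤x , x≤j

    -- A vertex of the interval missing from `W` lies under a side of `W` other than (i , j), hence
    -- is hidden. Conversely, by non-crossing, a proper edge over a vertex of `W` would have both
    -- ends in `W` and so be a side of `W`, which is impossible.
    unique : ∀ {W} → SubPolygon W → Within i j W → i ∈ W → j ∈ W → W ≡ V
    unique {W} S within i∈ j∈ = Subset.⊆-antisym W⊆V V⊆W
      where
      separate-inside : ∀ {a} → a ∉ W → i Fin.≤ a → a Fin.≤ j → Separation W a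
      separate-inside a∉ i≤a a≤j = separate a∉ (i , i∈ , i≤a) (j , j∈ , a≤j)

      -- If `i` and `j` were the neighbours of `x` in `W`, then `W` would have no third vertex.
      not-chord : ∀ {x} (s : Separation W x) → ¬ (Separation.p s ≡ i × Separation.q s ≡ j)
      not-chord {x} (separation _ _ _ before after) (refl , refl)
        with u , u∈ , u≢i , u≢j ← third (proj₁ S) i j | ℕ.≤-total (toℕ u) (toℕ x)
      ... | inj₁ u≤x = u≢i (Fin.≤-antisym (before u∈ u≤x) (proj₁ (within u u∈)))
      ... | inj₂ x≤u = u≢j (Fin.≤-antisym (proj₂ (within u u∈)) (after u∈ x≤u))

      V⊆W : ∀ {x} → x ∈ V → x ∈ W
      V⊆W {x} x∈V = decidable-stable (x ∈? W) λ x∉W →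
        let i≤x , x≤j , ¬hidden = V-visible x∈V
            s = separate-inside x∉W i≤x x≤j
            open Separation s
        in ¬hidden (p , q , (side⇒edge S side , not-chord s) ,
             proj₁ (within p (proj₁ side)) , p<a , a<q , proj₂ (within q (proj₁ (proj₂ side))))

      W⊆V : ∀ {x} → x ∈ W → x ∈ V
      W⊆V {x} x∈ with i≤x , x≤j ← within x x∈ = ∈⟦⟧⁺ visible? (i≤x , x≤j , ¬hidden)
        where
        ¬hidden : ¬ Hidden x
        ¬hidden (a , b , (edge , ≢ij) , i≤a , a<x , x<b , b≤j) = impossible (edge⇒side S a∈ b∈ edge)
          where
          a≤j = ℕ.≤-trans (ℕ.<⇒≤ a<x) (ℕ.≤-trans (ℕ.<⇒≤ x<b) b≤j)
          i≤b = ℕ.≤-trans i≤a (ℕ.≤-trans (ℕ.<⇒≤ a<x) (ℕ.<⇒≤ x<b))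
          a∈ : a ∈ W
          -- If `a` were missing, the side of `W` separating it would end at or before `x`, hence
          -- before `b`, and cross (a , b).
          a∈ = decidable-stable (a ∈? W) λ a∉ →
            let open Separation (separate-inside a∉ i≤a a≤j)
            in edge-noncrossing (side⇒edge S side) edge
                 (p<a , a<q , ℕ.≤-<-trans (after x∈ (ℕ.<⇒≤ a<x)) x<b)
          b∈ : b ∈ W
          b∈ = decidable-stable (b ∈? W) λ b∉ →
            let open Separation (separate-inside b∉ i≤b b≤j)
            in edge-noncrossing edge (side⇒edge S side)
                 (ℕ.<-≤-trans a<x (before x∈ (ℕ.<⇒≤ x<b)) , p<a , a<q)
          impossible : ¬ Side W a b
          impossible (_ , _ , _ , inj₁ none) = none x x∈ (a<x , x<b)
          impossible (_ , _ , _ , inj₂ all)  =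
            ≢ij (Fin.≤-antisym (proj₁ (all i i∈)) i≤a , Fin.≤-antisym b≤j (proj₂ (all j j∈)))

    -- The chord through the first and last vertex of a sub-polygon on both
    -- sides of v can only end at w and would hide v.
    within-split : ∀ {v w W} → v ∈ V → Edge v w → w Fin.≤ j → SubPolygon W → Within i w W →
      W ≡ V ⊎ Within i v W ⊎ Within v w W
    within-split {v} {w} {W} v∈ edge w≤j S within with within? i v W | within? v w W
    ... | yes left | _         = inj₂ (inj₁ left)
    ... | no _     | yes right = inj₂ (inj₂ right)
    ... | no ¬left | no ¬right
      with u , u∈ , _ ← third (proj₁ S) v v
      with x , x∈ , x-min ← least (_∈? W) (u , u∈) | z , z∈ , z-max ← greatest (_∈? W) (u , u∈)
      = inj₁ (whole (toℕ z ℕ.<? toℕ w))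
      where
      x<v : x Fin.< v
      x<v = ℕ.≰⇒> λ v≤x → ¬right λ k k∈ → ℕ.≤-trans v≤x (x-min k∈) , proj₂ (within k k∈)
      v<z : v Fin.< z
      v<z = ℕ.≰⇒> λ z≤v → ¬left λ k k∈ → proj₁ (within k k∈) , ℕ.≤-trans (z-max k∈) z≤v
      outer : Edge x z
      outer = side⇒edge S (x∈ , z∈ , ℕ.<-trans x<v v<z , inj₂ λ k k∈ → x-min k∈ , z-max k∈)
      whole : Dec (toℕ z < toℕ w) → W ≡ V
      whole (yes z<w) = contradiction (x<v , v<z , z<w) (edge-noncrossing outer edge)
      whole (no z≮w) with x Fin.≟ i ×-dec z Fin.≟ j
      ... | yes (refl , refl) = unique S (λ k k∈ → proj₁ (within k k∈) , z-max k∈) x∈ z∈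
      ... | no ≢ij = contradiction
        (x , z , (outer , ≢ij) , proj₁ (within x x∈) , x<v , v<z , ℕ.≤-trans (proj₂ (within z z∈)) w≤j)
        (proj₂ (proj₂ (V-visible v∈)))

    module _ (ij : Edge i j) (long : suc (toℕ i) < toℕ j) where

      i∈V : i ∈ V
      i∈V = ∈⟦⟧⁺ visible? (ℕ.≤-refl , ℕ.<⇒≤ (edge-< ij) , λ { (_ , _ , _ , i≤a , a<i , _) → ℕ.<⇒≱ a<i i≤a })

      j∈V : j ∈ V
      j∈V = ∈⟦⟧⁺ visible? (ℕ.<⇒≤ (edge-< ij) , ℕ.≤-refl , λ { (_ , _ , _ , _ , _ , j<b , b≤j) → ℕ.<⇒≱ j<b b≤j })

      -- The sides of `V` other than (i , j), traversed from `i` to `j`.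
      record Next (v w : Fin n) : Set where
        field
          proper : Proper v w
          v∈V    : v ∈ V
          w∈V    : w ∈ V
          gap    : ∀ {x} → x ∈ V → v Fin.< x → ¬ x Fin.< w

        v<w : v Fin.< w
        v<w = edge-< (proj₁ proper)

      proper-gap : ∀ {v w} → v ∈ V → w ∈ V → Proper v w → ∀ {x} → x ∈ V → v Fin.< x → ¬ x Fin.< w
      proper-gap v∈ w∈ vw x∈ v<x x<w =
        proj₂ (proj₂ (V-visible x∈)) (_ , _ , vw , proj₁ (V-within _ v∈) , v<x , x<w , proj₂ (V-within _ w∈))

      opaque

        -- Take the longest proper edge from `v` that ends by `j`. An edge hiding its end `w` would
        -- hide `v` too if it starts before `v`, contradict the choice of `w` if it starts at `v`,
        -- and cross (v , w) if it starts later.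
        next : ∀ {v} → v ∈ V → v Fin.< j → ∃ λ w → Next v w
        next {v} v∈ v<j with greatest (λ b → proper? v b ×-dec b Fin.≤? j) (v⁺ , (edge-suc v⁺≡ , ≢ij) , v⁺≤j)
          where
          v⁺<n : suc (toℕ v) < n
          v⁺<n = ℕ.≤-<-trans v<j (Fin.toℕ<n j)
          v⁺ : Fin n
          v⁺ = fromℕ< v⁺<n
          v⁺≡ : toℕ v⁺ ≡ suc (toℕ v)
          v⁺≡ = Fin.toℕ-fromℕ< v⁺<n
          v⁺≤j : v⁺ Fin.≤ j
          v⁺≤j = subst (_≤ toℕ j) (sym v⁺≡) v<j
          -- The edge to the successor of `v` is a first candidate; it is not (i , j) since `j` is
          -- beyond the successor of `i`.
          ≢ij : ¬ (v ≡ i × v⁺ ≡ j)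
          ≢ij (refl , eq) = ℕ.<⇒≢ long (trans (sym v⁺≡) (cong toℕ eq))
        ... | w , (vw , w≤j) , w-max = w , record
          { proper = vw ; v∈V = v∈ ; w∈V = w∈ ; gap = proper-gap v∈ w∈ vw }
          where
          ¬hidden : ¬ Hidden w
          ¬hidden (a , b , ab , i≤a , a<w , w<b , b≤j) with Fin.<-cmp a v
          ... | tri< a<v _ _  = proj₂ (proj₂ (V-visible v∈)) (a , b , ab , i≤a , a<v , ℕ.<-trans (edge-< (proj₁ vw)) w<b , b≤j)
          ... | tri≈ _ refl _ = ℕ.<⇒≱ w<b (w-max (ab , b≤j))
          ... | tri> _ _ v<a  = edge-noncrossing (proj₁ vw) (proj₁ ab) (v<a , a<w , w<b)
          w∈ : w ∈ V
          w∈ = ∈⟦⟧⁺ visible? (ℕ.≤-trans (proj₁ (V-within v v∈)) (ℕ.<⇒≤ (edge-< (proj₁ vw))) , w≤j , ¬hidden)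

      walk : (P : Fin n → Set) → P i → (∀ {v w} → Next v w → P v → P w) → P j
      walk P Pi step = go (toℕ j) i∈V (ℕ.m≤m+n (toℕ j) (toℕ i)) Pi
        where
        -- The fuel bounds the remaining distance from `v` to `j`.
        go : ∀ fuel {v} → v ∈ V → toℕ j ≤ fuel + toℕ v → P v → P j
        go fuel {v} v∈ j≤ Pv with v Fin.≟ j
        ... | yes refl = Pv
        go zero       v∈ j≤ Pv | no v≢j = contradiction (Fin.≤-antisym (proj₂ (V-within _ v∈)) j≤) v≢j
        go (suc fuel) {v} v∈ j≤ Pv | no v≢j with w , nxt ← next v∈ (Fin.≤∧≢⇒< (proj₂ (V-within v v∈)) v≢j) =
          go fuel (Next.w∈V nxt)
            (ℕ.≤-trans j≤ (subst (_≤ fuel + toℕ w) (ℕ.+-suc fuel (toℕ v)) (ℕ.+-monoʳ-≤ fuel (Next.v<w nxt))))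
            (step nxt Pv)

      -- Besides `i` and `j` it contains the vertex next to `i`. Its sides are the steps of `next`
      -- and (i , j) itself, and a cut other than (i , j) between two of its vertices hides
      -- everything beneath it, so it is a side.
      V-subPolygon : SubPolygon V
      V-subPolygon = size , (λ x y → sides) , λ { x y (x∈ , y∈ , x<y , ¬side) cut → uncut x∈ y∈ x<y ¬side cut }
        where
        size : 3 ≤ ∣ V ∣
        size with w , nxt ← next i∈V (edge-< ij) =
          three i∈V (Next.w∈V nxt) j∈V (Next.v<w nxt)
            (Fin.≤∧≢⇒< (proj₂ (V-within w (Next.w∈V nxt))) λ w≡j → proj₂ (Next.proper nxt) (refl , w≡j))
        sides : ∀ {x y} → Side V x y → Edge x y
        sides {x} {y} (x∈ , y∈ , x<y , inj₁ none)
          with w , nxt ← next x∈ (ℕ.<-≤-trans x<y (proj₂ (V-within y y∈))) =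
          subst (Edge x) (Fin.≤-antisym (ℕ.≮⇒≥ (Next.gap nxt y∈ x<y)) (ℕ.≮⇒≥ λ w<y → none w (Next.w∈V nxt) (Next.v<w nxt , w<y))) (proj₁ (Next.proper nxt))
        sides {x} {y} (x∈ , y∈ , x<y , inj₂ all) =
          subst₂ Edge (Fin.≤-antisym (proj₁ (V-within x x∈)) (proj₁ (all i i∈V)))
                      (Fin.≤-antisym (proj₂ (all j j∈V)) (proj₂ (V-within y y∈))) ij
        uncut : ∀ {x y} → x ∈ V → y ∈ V → x Fin.< y → ¬ Side V x y → ¬ Cut x y
        uncut {x} {y} x∈ y∈ x<y ¬side cut with x Fin.≟ i ×-dec y Fin.≟ j
        ... | yes (refl , refl) = ¬side (x∈ , y∈ , x<y , inj₂ V-within)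
        ... | no ≢ij = ¬side (x∈ , y∈ , x<y , inj₁ λ k k∈ (x<k , k<y) → proper-gap x∈ y∈ (inj₂ cut , ≢ij) k∈ x<k k<y)

-- The matrix of an edge

even? : ∀ {n} → Decidable (λ (W : Subset n) → 2 ∣ ∣ W ∣)
even? W = 2 ∣? ∣ W ∣

module Counting {n} (D : Dissection n) (is3d : Dissection.Is3d D) where
  open Chords D

  module _ {T : Subset n → Set} (T? : Decidable T) where

    #within : Fin n → Fin n → ℕ
    #within i j = count λ W → (subPolygon? W ×-dec within? i j W) ×-dec T? W

    #within-none : ∀ {i j} → (∀ {W} → SubPolygon W → Within i j W → ¬ T W) → #within i j ≡ 0
    #within-none none = count-none _ λ ((S , within) , t) → none S within t

  Q : Fin n → Fin n → ℕ → Mat₂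
  Q i j k = A (ℤ.+ #within (k ∈ᴺ?_) i j)

  -- The witness `d` is j - i, so the product has d + 1 factors, both ends included.
  ChordProduct : Fin n → Fin n → Set
  ChordProduct i j = ∃ λ d → toℕ j ≡ d + toℕ i × ∏ (Q i j) (toℕ i) (suc d) ≡ ⊖ ⊖^ (#within even? i j) Id

  -- No sub-polygon fits between consecutive vertices, so all counts vanish and the product is A(0)²
  -- = -Id.
  side-product : ∀ {i j} → toℕ j ≡ suc (toℕ i) → ChordProduct i j
  side-product {i} {j} j≡ = 1 , j≡ , product
    where
    empty : ∀ {W} → SubPolygon W → ¬ Within i j W
    empty S within with u , u∈ , u≢i , u≢j ← third (proj₁ S) i j with i≤u , u≤j ← within u u∈ =
      u≢j (Fin.≤-antisym u≤j (subst (_≤ toℕ u) (sym j≡) (Fin.≤∧≢⇒< i≤u (u≢i ∘ sym))))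
    product : ∏ (Q i j) (toℕ i) 2 ≡ ⊖ ⊖^ (#within even? i j) Id
    product = trans
      (cong₂ (λ a b → (Id ⊗ A (ℤ.+ a)) ⊗ A (ℤ.+ b)) (none (suc (toℕ i) ∈ᴺ?_)) (none (toℕ i ∈ᴺ?_)))
      (cong (λ e → ⊖ ⊖^ e Id) (sym (none even?)))
      where
      none : {T : Subset n → Set} (T? : Decidable T) → #within T? i j ≡ 0
      none T? = #within-none T? λ S within _ → empty S within

  -- `W` would have no vertex but `v`. With `i`, `v`, `w` equal, this says that no sub-polygon lies
  -- in a single vertex.
  within-disjoint : ∀ {i v w W} → SubPolygon W → Within i v W → ¬ Within v w W
  within-disjoint {v = v} S left right with u , u∈ , u≢v , _ ← third (proj₁ S) v v =
    u≢v (Fin.≤-antisym (proj₂ (left u u∈)) (proj₁ (right u u∈)))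

  within-∈ᴺ : ∀ {i j k W} → Within i j W → k ∈ᴺ W → toℕ i ≤ k × k ≤ toℕ j
  within-∈ᴺ within (x , refl , x∈) = within x x∈

  module Walk {i j : Fin n} (ij : Edge i j) (long : suc (toℕ i) < toℕ j) where
    open Polygon i j

    Part : Fin n → Subset n → Set
    Part v W = W ≡ V ⊎ (SubPolygon W × Within i v W)

    part? : ∀ v → Decidable (Part v)
    part? v W = Vec.≡-dec Bool._≟_ W V ⊎-dec (subPolygon? W ×-dec within? i v W)

    -- V is counted from the start, so that the step from v to w only adds the
    -- sub-polygons beyond the chord (v , w).
    #part : Fin n → {T : Subset n → Set} → Decidable T → ℕ
    #part v T? = count λ W → part? v W ×-dec T? W

    module _ {T : Subset n → Set} (T? : Decidable T) where

      #part-one : ∀ {v} → T V → (∀ {W} → SubPolygon W → Within i v W → ¬ T W) → #part v T? ≡ 1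
      #part-one t none = count-one _ V (inj₁ refl , t) λ
        { (inj₁ W≡V , _) → W≡V
        ; (inj₂ (S , within) , t) → contradiction t (none S within) }

      #part-zero : ∀ {v} → ¬ T V → (∀ {W} → SubPolygon W → Within i v W → ¬ T W) → #part v T? ≡ 0
      #part-zero ¬t none = count-none _ λ
        { (inj₁ refl , t) → ¬t t
        ; (inj₂ (S , within) , t) → none S within t }

      -- `V` is itself a sub-polygon within [i , j], so at `j` counting it separately changes
      -- nothing.
      #part-whole : #part j T? ≡ #within T? i j
      #part-whole = count-cong _ _
        (λ { (inj₁ refl , t) → (V-subPolygon ij long , V-within) , t ; (inj₂ S , t) → S , t })
        (λ (S , t) → inj₂ S , t)

      -- By `within-split`, a newly counted sub-polygon lies beyond (v , w). `V` is not among these,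
      -- since it contains `i` and `j` while (v , w) is proper.
      #part-next : ∀ {v w} → Next ij long v w → #part w T? ≡ #part v T? + #within T? v w
      #part-next {v} {w} nxt = count-⊎ _ _ _ narrow (λ { (p , t) → widen p , t }) right disjoint
        where
        open Next nxt
        narrow : ∀ {W} → Part w W × T W → (Part v W × T W) ⊎ ((SubPolygon W × Within v w W) × T W)
        narrow (inj₁ W≡V , t) = inj₁ (inj₁ W≡V , t)
        narrow (inj₂ (S , within) , t) with within-split v∈V (proj₁ proper) (proj₂ (V-within w w∈V)) S within
        ... | inj₁ W≡V          = inj₁ (inj₁ W≡V , t)
        ... | inj₂ (inj₁ left)  = inj₁ (inj₂ (S , left) , t)
        ... | inj₂ (inj₂ right) = inj₂ ((S , right) , t)
        widen : ∀ {W} → Part v W → Part w W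
        widen (inj₁ W≡V) = inj₁ W≡V
        widen (inj₂ (S , within)) = inj₂ (S , λ x x∈ → proj₁ (within x x∈) , ℕ.≤-trans (proj₂ (within x x∈)) (ℕ.<⇒≤ v<w))
        right : ∀ {W} → (SubPolygon W × Within v w W) × T W → Part w W × T W
        right ((S , within) , t) = inj₂ (S , λ x x∈ → ℕ.≤-trans (proj₁ (V-within v v∈V)) (proj₁ (within x x∈)) , proj₂ (within x x∈)) , t
        disjoint : ∀ {W} → Part v W × T W → ¬ ((SubPolygon W × Within v w W) × T W)
        disjoint (inj₁ refl , _) ((_ , within) , _) = proj₂ proper
          ( Fin.≤-antisym (proj₁ (within i (i∈V ij long))) (proj₁ (V-within v v∈V))
          , Fin.≤-antisym (proj₂ (V-within w w∈V)) (proj₂ (within j (j∈V ij long))))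
        disjoint (inj₂ (S , left) , _) ((_ , within) , _) = within-disjoint S left within

    #at : Fin n → ℕ → ℕ
    #at v k = #part v (k ∈ᴺ?_)

    #even : Fin n → ℕ
    #even v = #part v even?

    -- #even i is 1 or 0 according to the parity of V, and cancels the count of V
    -- in #even v.
    PrefixProduct : Fin n → Set
    PrefixProduct v = ∃ λ d → toℕ v ≡ d + toℕ i ×
      ∏ (λ k → A (ℤ.+ #at v k)) (toℕ i) (suc d) ≡ ⊖^ (#even i + #even v) (∏ (factor V) (toℕ i) (suc d))

    -- Only `V` is counted at `x`: the other parts end at `v`, before `x`, and for v = i there are
    -- none.
    #at-end : ∀ {v x} → x ∈ V → (v Fin.< x ⊎ v ≡ i) → #at v (toℕ x) ≡ 1
    #at-end {v} {x} x∈ beyond = #part-one (toℕ x ∈ᴺ?_) (x , refl , x∈) (none beyond)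
      where
      none : v Fin.< x ⊎ v ≡ i → ∀ {W} → SubPolygon W → Within i v W → ¬ (toℕ x ∈ᴺ W)
      none (inj₁ v<x)  S within x∈W = ℕ.<⇒≱ v<x (proj₂ (within-∈ᴺ within x∈W))
      none (inj₂ refl) S within _   = within-disjoint S within within

    prefix-start : PrefixProduct i
    prefix-start = 0 , refl , (begin
      Id ⊗ A (ℤ.+ #at i (toℕ i))
        ≡⟨ cong (λ a → Id ⊗ A (ℤ.+ a)) (#at-end (i∈V ij long) (inj₂ refl)) ⟩
      Id ⊗ A 1ℤ
        ≡⟨ cong (Id ⊗_) (factor-∈ (i∈V ij long)) ⟨
      Id ⊗ factor V (toℕ i)
        ≡⟨ ⊖^-involutive (#even i) (Id ⊗ factor V (toℕ i)) ⟨
      ⊖^ (#even i) (⊖^ (#even i) (Id ⊗ factor V (toℕ i)))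
        ≡⟨ ⊖^-+ (#even i) (#even i) (Id ⊗ factor V (toℕ i)) ⟨
      ⊖^ (#even i + #even i) (Id ⊗ factor V (toℕ i)) ∎)
      where open ≡-Reasoning

    prefix-next : ∀ {v w} → Next ij long v w → ChordProduct v w → PrefixProduct v → PrefixProduct w
    prefix-next {v} {w} nxt (zero , w≡ , _) _ = contradiction (ℕ.≤-reflexive w≡) (ℕ.<⇒≱ (Next.v<w nxt))
    prefix-next {v} {w} nxt (suc e , w≡ , chord) (d , v≡ , prefix) =
      d + suc e ,
      trans w≡ (trans (cong (suc e +_) v≡) (trans (sym (ℕ.+-assoc (suc e) d (toℕ i))) (cong (_+ toℕ i) (ℕ.+-comm (suc e) d)))) ,
      subst (λ x → ∏ (λ k → A (ℤ.+ #at w k)) (toℕ i) (suc (d + suc e)) ≡ ⊖^ x (∏ (factor V) (toℕ i) (suc (d + suc e))))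
        (trans (ℕ.+-assoc (#even i) (#even v) (#within even? v w)) (cong (#even i +_) (sym (#part-next even? nxt))))
        (∏-glue {#at v} {#at w} {q} {factor V} {toℕ i} {d} {toℕ v} {e} {toℕ w} {#even i + #even v} {#within even? v w} v≡ w≡ below at-v between at-w (λ v<k k<w → factor-∉ V _ (no-vertex v<k k<w))
          (factor-∈ w∈V) prefix chord)
      where
      open Next nxt
      q : ℕ → ℕ
      q k = #within (k ∈ᴺ?_) v w
      no-vertex : ∀ {k} → toℕ v < k → k < toℕ w → ¬ (k ∈ᴺ V)
      no-vertex v<k k<w (x , refl , x∈) = gap x∈ v<k k<w
      below : ∀ {k} → k < toℕ v → #at w k ≡ #at v k
      below {k} k<v = trans (#part-next (k ∈ᴺ?_) nxt)
        (trans (cong (#at v k +_) (#within-none (k ∈ᴺ?_) {v} {w} λ _ within k∈ → ℕ.<⇒≱ k<v (proj₁ (within-∈ᴺ within k∈))))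
          (ℕ.+-identityʳ (#at v k)))
      at-v : #at w (toℕ v) ≡ q (toℕ v) + #at v (toℕ v)
      at-v = trans (#part-next (toℕ v ∈ᴺ?_) nxt) (ℕ.+-comm (#at v (toℕ v)) (q (toℕ v)))
      between : ∀ {k} → toℕ v < k → k < toℕ w → #at w k ≡ q k
      between {k} v<k k<w = trans (#part-next (k ∈ᴺ?_) nxt)
        (cong (_+ q k) (#part-zero (k ∈ᴺ?_) (no-vertex v<k k<w) λ _ within k∈ → ℕ.<⇒≱ v<k (proj₂ (within-∈ᴺ within k∈))))
      at-w : #at w (toℕ w) ≡ 1 + q (toℕ w)
      at-w = trans (#part-next (toℕ w ∈ᴺ?_) nxt) (cong (_+ q (toℕ w)) (#at-end w∈V (inj₁ v<w)))

    -- The factors outside [i , j] are `Id`, so the product is A(1)^∣V∣. For even ∣V∣ it is `Id` and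
    -- `#even i` is 1; for odd ∣V∣ it is -Id and `#even i` is 0.
    factor-product : ∀ {d} → toℕ j ≡ d + toℕ i → ∏ (factor V) (toℕ i) (suc d) ≡ ⊖ ⊖^ (#even i) Id
    factor-product {d} j≡ = begin
      ∏ (factor V) (toℕ i) (suc d)          ≡⟨ ∏-support (toℕ i) (suc d) r before after ⟨
      ∏ (factor V) 0 (suc d + toℕ i + r)    ≡⟨ cong (∏ (factor V) 0) (trans (cong (λ x → suc x + r) (sym j≡)) j+r≡n) ⟩
      ∏ (factor V) 0 n                      ≡⟨ ∏-factor V ⟩
      A₁^ ∣ V ∣                             ≡⟨ parity (2 ∣? ∣ V ∣) ⟩
      ⊖ ⊖^ (#even i) Id                     ∎
      where
      open ≡-Reasoning
      r : ℕ
      r = proj₁ (ℕ.m≤n⇒∃[o]m+o≡n (Fin.toℕ<n j))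
      j+r≡n : suc (toℕ j) + r ≡ n
      j+r≡n = proj₂ (ℕ.m≤n⇒∃[o]m+o≡n (Fin.toℕ<n j))
      before : ∀ {k} → k < toℕ i → factor V k ≡ Id
      before {k} k<i = factor-∉ V k λ k∈ → ℕ.<⇒≱ k<i (proj₁ (within-∈ᴺ V-within k∈))
      after : ∀ {k} → suc d + toℕ i ≤ k → factor V k ≡ Id
      after {k} j<k = factor-∉ V k λ k∈ → ℕ.<⇒≱ (subst (_< k) (sym j≡) j<k) (proj₂ (within-∈ᴺ V-within k∈))
      3∣V : 3 ∣ ∣ V ∣
      3∣V = All.lookup is3d (ListMem.∈-filter⁺ subPolygon? (∈-subsets V) (V-subPolygon ij long))
      empty : ∀ {W} → SubPolygon W → Within i i W → ¬ 2 ∣ ∣ W ∣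
      empty S within _ = within-disjoint S within within
      parity : Dec (2 ∣ ∣ V ∣) → A₁^ ∣ V ∣ ≡ ⊖ ⊖^ (#even i) Id
      parity (yes even) = trans (A₁^-even 3∣V even) (cong (λ e → ⊖ ⊖^ e Id) (sym (#part-one even? even empty)))
      parity (no odd)   = trans (A₁^-odd 3∣V odd) (cong (λ e → ⊖ ⊖^ e Id) (sym (#part-zero even? odd empty)))

    walk-product : (∀ {v w} → Next ij long v w → ChordProduct v w) → ChordProduct i j
    walk-product chords = close (walk ij long PrefixProduct prefix-start (λ nxt → prefix-next nxt (chords nxt)))
      where
      open ≡-Reasoning
      close : PrefixProduct j → ChordProduct i j
      close (d , j≡ , prefix) = d , j≡ , (begin
        ∏ (Q i j) (toℕ i) (suc d)
          ≡⟨ ∏-cong (toℕ i) (suc d) (λ k _ _ → cong (λ a → A (ℤ.+ a)) (#part-whole (k ∈ᴺ?_))) ⟨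
        ∏ (λ k → A (ℤ.+ #at j k)) (toℕ i) (suc d)
          ≡⟨ prefix ⟩
        ⊖^ (#even i + #even j) (∏ (factor V) (toℕ i) (suc d))
          ≡⟨ cong (⊖^ (#even i + #even j)) (factor-product j≡) ⟩
        ⊖^ (#even i + #even j) (⊖ ⊖^ (#even i) Id)
          ≡⟨ trans (cong (λ e → ⊖^ e (⊖ ⊖^ (#even i) Id)) (ℕ.+-comm (#even i) (#even j))) (⊖^-+ (#even j) (#even i) (⊖ ⊖^ (#even i) Id)) ⟩
        ⊖^ (#even j) (⊖^ (#even i) (⊖^ (suc (#even i)) Id))
          ≡⟨ cong (⊖^ (#even j)) (⊖^-⊖ (#even i) (⊖^ (#even i) Id)) ⟩
        ⊖^ (#even j) (⊖ ⊖^ (#even i) (⊖^ (#even i) Id))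
          -- The auxiliary sign of the prefix cancels that of the factors of `V`, leaving `V`
          -- counted once, in `#even j`.
          ≡⟨ cong (λ X → ⊖^ (#even j) (⊖ X)) (⊖^-involutive (#even i) Id) ⟩
        ⊖^ (#even j) (⊖ Id)
          ≡⟨ ⊖^-⊖ (#even j) Id ⟩
        ⊖ ⊖^ (#even j) Id
          ≡⟨ cong (λ e → ⊖ ⊖^ e Id) (#part-whole even?) ⟩
        ⊖ ⊖^ (#within even? i j) Id ∎)

  -- A proper edge inside [i , j] is strictly shorter than (i , j); this is the descent for the
  -- inductions on fuel, which bounds j - i.
  shrink : ∀ {i j v w : Fin n} {fuel} → ¬ (v ≡ i × w ≡ j) → i Fin.≤ v → w Fin.≤ j →
    toℕ j < suc fuel + toℕ i → toℕ w < fuel + toℕ v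
  shrink {i} {j} {v} {w} {fuel} ≢ij i≤v w≤j j< with v Fin.≟ i
  ... | yes refl = ℕ.<-≤-trans (Fin.≤∧≢⇒< w≤j (λ w≡j → ≢ij (refl , w≡j))) (ℕ.≤-pred j<)
  ... | no v≢i   = ℕ.≤-<-trans (ℕ.≤-trans w≤j (ℕ.≤-pred j<)) (ℕ.+-monoʳ-< fuel (Fin.≤∧≢⇒< i≤v (v≢i ∘ sym)))

  edge-product : ∀ fuel {i j} → Edge i j → toℕ j < fuel + toℕ i → ChordProduct i j
  edge-product zero       ij j<i = contradiction (ℕ.<⇒≤ (edge-< ij)) (ℕ.<⇒≱ j<i)
  edge-product (suc fuel) {i} {j} ij j< = Sum.[ long , side-product ∘ sym ] (ℕ.m≤n⇒m<n∨m≡n (edge-< ij))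
    where
    open Polygon i j
    long : suc (toℕ i) < toℕ j → ChordProduct i j
    long i+1<j = Walk.walk-product ij i+1<j λ {v} {w} nxt → let open Next nxt in
      edge-product fuel (proj₁ proper)
        (shrink (proj₂ proper) (proj₁ (V-within v v∈V)) (proj₂ (V-within w w∈V)) j<)

  -- A visible `x` is a vertex of the polygon at (i , j). A hidden one lies strictly under a shorter
  -- edge, where the search continues. Positivity of the terms rests on this.
  covered : ∀ fuel {i j} → Edge i j → toℕ j < fuel + toℕ i → ∀ {x} → i Fin.< x → x Fin.< j →
    ∃ λ W → SubPolygon W × x ∈ W
  covered zero       ij j<i _ _ = contradiction (ℕ.<⇒≤ (edge-< ij)) (ℕ.<⇒≱ j<i)
  covered (suc fuel) {i} {j} ij j< {x} i<x x<j = cases (hidden? x)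
    where
    open Polygon i j
    cases : Dec (Hidden x) → ∃ λ W → SubPolygon W × x ∈ W
    cases (no ¬hidden) = V , V-subPolygon ij (ℕ.≤-<-trans i<x x<j) , ∈⟦⟧⁺ visible? (ℕ.<⇒≤ i<x , ℕ.<⇒≤ x<j , ¬hidden)
    cases (yes (a , b , (ab , ≢ij) , i≤a , a<x , x<b , b≤j)) =
      covered fuel ab (shrink ≢ij i≤a b≤j j<) a<x x<b

-- Quiddity sequences

module Whole {n} (D : Dissection (suc (suc (suc n)))) (is3d : Is3d D) where
  open Chords D
  open Counting D is3d

  last : Fin (suc (suc (suc n)))
  last = fromℕ (suc (suc n))

  rim : Edge zero last
  rim = inj₁ (Subset.∈⊤ , Subset.∈⊤ , s≤s z≤n , inj₂ λ k _ → z≤n , Fin.≤fromℕ k)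

  long : 1 < toℕ last
  long = s≤s (s≤s z≤n)

  enough : toℕ last < suc (toℕ last) + 0
  enough = s≤s (ℕ.m≤m+n (toℕ last) 0)

  -- Every set of vertices lies between the first and the last vertex, so the restriction to the
  -- interval of `rim` is vacuous.
  filter-subPolygons : {T T′ : Subset _ → Set} (T? : Decidable T) (T′? : Decidable T′) →
    (∀ {W} → T W → T′ W) → (∀ {W} → T′ W → T W) →
    length (filter T? subPolygons) ≡ #within T′? zero last
  filter-subPolygons T? T′? T⇒T′ T′⇒T = begin
    length (filter T? subPolygons)
      ≡⟨ cong length (filter-filter T? subPolygon? (subsets _)) ⟩
    length (filter (λ W → subPolygon? W ×-dec T? W) (subsets _))
      ≡⟨ count≡length-filter (λ W → subPolygon? W ×-dec T? W) ⟨
    count (λ W → subPolygon? W ×-dec T? W)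
      ≡⟨ count-cong (λ W → subPolygon? W ×-dec T? W) (λ W → (subPolygon? W ×-dec within? zero last W) ×-dec T′? W)
           (λ (S , t) → (S , λ x _ → z≤n , Fin.≤fromℕ x) , T⇒T′ t) (λ ((S , _) , t) → S , T′⇒T t) ⟩
    #within T′? zero last ∎
    where open ≡-Reasoning

  degree : Fin (suc (suc (suc n))) → ℕ
  degree x = length (filter (x ∈?_) subPolygons)

  degree-within : ∀ x → degree x ≡ #within (toℕ x ∈ᴺ?_) zero last
  degree-within x = filter-subPolygons (x ∈?_) (toℕ x ∈ᴺ?_) (λ x∈ → x , refl , x∈)
    (λ { (y , y≡x , y∈) → subst (_∈ _) (Fin.toℕ-injective y≡x) y∈ })

  vertex-covered : ∀ x → ∃ λ W → SubPolygon W × x ∈ W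
  vertex-covered x = cases (x Fin.≟ zero) (x Fin.≟ last)
    where
    open Polygon zero last
    cases : Dec (x ≡ zero) → Dec (x ≡ last) → ∃ λ W → SubPolygon W × x ∈ W
    cases (yes x≡0) _            = V , V-subPolygon rim long , subst (_∈ V) (sym x≡0) (i∈V rim long)
    cases (no _)    (yes x≡last) = V , V-subPolygon rim long , subst (_∈ V) (sym x≡last) (j∈V rim long)
    cases (no x≢0)  (no x≢last)  = covered (suc (toℕ last)) rim enough
      (Fin.≤∧≢⇒< z≤n (x≢0 ∘ sym)) (Fin.≤∧≢⇒< (Fin.≤fromℕ x) x≢last)

  degree-positive : ∀ x → 0 < degree x
  degree-positive x = let W , S , x∈ = vertex-covered x in
    subst (0 <_) (trans (count≡length-filter _) (cong length (sym (filter-filter (x ∈?_) subPolygon? (subsets _)))))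
      (count-some (λ W → subPolygon? W ×-dec x ∈? W) (S , x∈))

  evens : ℕ
  evens = length (filter (λ W → 2 ∣? ∣ W ∣) subPolygons)

  M-quiddity : M (map ℤ.+_ (quiddity D)) ≡ ⊖ ⊖^ evens Id
  M-quiddity = close (edge-product (suc (toℕ last)) rim enough)
    where
    open ≡-Reasoning
    close : ChordProduct zero last → M (map ℤ.+_ (quiddity D)) ≡ ⊖ ⊖^ evens Id
    close (d , last≡ , product) = begin
      M (map ℤ.+_ (tabulate degree))
        ≡⟨ M-tabulate degree (λ k → #within (k ∈ᴺ?_) zero last) 0
             (λ x → trans (degree-within x) (cong (λ k → #within (k ∈ᴺ?_) zero last) (sym (ℕ.+-identityʳ (toℕ x))))) ⟩
      ∏ (Q zero last) 0 (suc (suc (suc n)))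
        ≡⟨ cong (λ m → ∏ (Q zero last) 0 (suc m)) (trans (sym (Fin.toℕ-fromℕ (suc (suc n)))) (trans last≡ (ℕ.+-identityʳ d))) ⟩
      ∏ (Q zero last) 0 (suc d)
        ≡⟨ product ⟩
      ⊖ ⊖^ (#within even? zero last) Id
        ≡⟨ cong (λ e → ⊖ ⊖^ e Id) (filter-subPolygons (λ W → 2 ∣? ∣ W ∣) even? (λ t → t) (λ t → t)) ⟨
      ⊖ ⊖^ evens Id ∎

  quiddity-solution : ∀ e → ⊖ ⊖^ evens Id ≡ ⊖^ e Id → Solution e (suc (suc (suc n))) (quiddity D)
  quiddity-solution e sign = List.length-tabulate degree , All.tabulate⁺ degree-positive , trans M-quiddity sign

even-solution : ∀ {n} (D : Dissection n) → Is3d D → 3 ≤ n → Even D → Solution 1 n (quiddity D)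
even-solution D is3d (s≤s (s≤s (s≤s z≤n))) even = Whole.quiddity-solution D is3d 1 (cong ⊖_ (⊖^-even even))

odd-solution : ∀ {n} (D : Dissection n) → Is3d D → 3 ≤ n → Odd D → Solution 2 n (quiddity D)
odd-solution D is3d (s≤s (s≤s (s≤s z≤n))) odd = Whole.quiddity-solution D is3d 2 (cong ⊖_ (⊖^-odd odd))

products : ∀ {e N L s t} → 3 ≤ N → 3 ≤ L → Solution e N s → Solution e L t → ∀ k → 1 ≤ k → k ≤ N →
  IsPositiveSolution (N + L ∸ 1) (s ∘[ k ] t) × IsPositiveSolution (N + L ∸ 1) (s •[ k ] t)
products 3≤N 3≤L S T k 1≤k k≤N =
  ∘-solution (ℕ.<⇒≤ 3≤N) (ℕ.<⇒≤ 3≤L) S T k 1≤k k≤N , •-solution (ℕ.<⇒≤ 3≤N) (ℕ.<⇒≤ 3≤L) S T k 1≤k k≤N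

theorem11 : ∀ (n m : ℕ) → 3 ≤ n → 3 ≤ m →
    (D : Dissection n) (E : Dissection m) → Is3d D → Is3d E →
    (Even D × Even E) ⊎ (Odd D × Odd E) →
    ∀ (k : ℕ) → 1 ≤ k → k ≤ n →
    IsPositiveSolution (n + m ∸ 1) (quiddity D ∘[ k ] quiddity E) ×
    IsPositiveSolution (n + m ∸ 1) (quiddity D •[ k ] quiddity E)
theorem11 n m 3≤n 3≤m D E D3d E3d (inj₁ (D-even , E-even)) =
  products {1} 3≤n 3≤m (even-solution D D3d 3≤n D-even) (even-solution E E3d 3≤m E-even)
theorem11 n m 3≤n 3≤m D E D3d E3d (inj₂ (D-odd , E-odd)) =
  products {2} 3≤n 3≤m (odd-solution D D3d 3≤n D-odd) (odd-solution E E3d 3≤m E-odd)
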